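{- $\mathrm{LOP} \notin \mathsf{sAvoid}^{dt}$; that is, the Linear Ordering Principle does not admit an efficient (complexity $\mathrm{polylog}$ in the input length) decision-tree reduction (formulation) to Strong Avoid.
   Context: A query search problem is a sequence $R=(R_n)$ of relations $R_n\subseteq\{0,1\}^n\times\mathcal{O}_n$; it is total if every $x\in\{0,1\}^n$ has some $o$ with $(x,o)\in R_n$. $R$ belongs to $\mathrm{TF}\Sigma_2^{dt}$ if it is total and for every $n$ and $o\in\mathcal{O}_n$ there are decision trees $V_{o,z}$ of depth $\mathrm{polylog}(n)$, one for each string $z$ of length $\ell=\mathrm{polylog}(n)$, such that $R_n(x,o)$ holds iff $V_{o,z}(x)=1$ for all such $z$. For total search problems $R\subseteq\{0,1\}^n\times\mathcal{O}_n$ and $S\subseteq\{0,1\}^m\times\mathcal{O}'_m$, an $S$-formulation of $R$ consists of functions $f_i:\{0,1\}^n\to\{0,1\}$ ($i\in[m]$) and $g_o:\{0,1\}^n\to\mathcal{O}_n$ ($o\in\mathcal{O}'_m$) such that $S(f(x),o)\Rightarrow R(x,g_o(x))$ where $f(x)=(f_1(x),\dots,f_m(x))$. Its depth $d$ is the maximum decision-tree depth of the $f_i$ and $g_o$, its size is $m$, and its complexity is $\log m+d$. For sequences $R=(R_n)$, $S=(S_m)$, the complexity of reducing $R_n$ to $S$ is the minimum over $m$ and over $S_m$-formulations of $R_n$ of the complexity; $R\le_{dt}S$ if this is $\mathrm{polylog}(n)$. Strong Avoid ($\mathrm{sAvoid}$): the input is a function $C:[2^n]\to[2^n+1]$ given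 by its bits (values in binary); a solution is $y\in[2^n+1]$ with $C(x)\neq y$ for all $x\in[2^n]$. $\mathsf{sAvoid}^{dt}$ is the class of problems $Q\in\mathrm{TF}\Sigma_2^{dt}$ with $Q\le_{dt}\mathrm{sAvoid}$. Linear Ordering Principle ($\mathrm{LOP}$): the input is a relation $\prec$ on $[N]$, $N=2^n$, given by bits $x_{i,j}$ ($i,j\in[N]$, $x_{i,j}=1$ meaning $i\prec j$); a solution is either an element $a$ with $a\prec b$ for every $b\neq a$ (minimal element), or distinct $a,b,c$ witnessing a violation of linear order: $a\prec a$, or ($a\not\prec b$ and $b\not\prec a$), or ($a\prec b$, $b\prec c$, $a\not\prec c$). -}

module Defs where

open import Data.Nat using (ℕ; zero; suc; _+_; _*_; _^_; _≤_; _⊔_)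
open import Data.Nat.Logarithm using (⌈log₂_⌉)
open import Data.Bool using (Bool; true; false; if_then_else_)
open import Data.Fin using (Fin; toℕ)
open import Data.Product using (_×_; _,_)
open import Data.Sum using (_⊎_)
open import Relation.Binary.PropositionalEquality using (_≡_; _≢_)

data DT (V : Set) (O : Set) : Set where
  leaf : O → DT V O
  node : V → DT V O → DT V O → DT V O

eval : {V O : Set} → DT V O → (V → Bool) → O
eval (leaf o)     x = o
eval (node v l r) x = if x v then eval r x else eval l x

depth : {V O : Set} → DT V O → ℕ
depth (leaf _)     = 0
depth (node _ l r) = suc (depth l ⊔ depth r)

SearchProblem : Set → Set → Set₁
SearchProblem V O = (V → Bool) → O → Set

-- An S-formulation of R of depth at most d (size = number of variables of S).
record Formulation {V W O O' : Set}
                   (R : SearchProblem V O) (S : SearchProblem W O') (d : ℕ) : Set where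
  field
    f       : W → DT V Bool
    g       : O' → DT V O
    f-depth : ∀ w → depth (f w) ≤ d
    g-depth : ∀ o → depth (g o) ≤ d
    correct : ∀ (x : V → Bool) (o : O') →
              S (λ w → eval (f w) x) o → R x (eval (g o) x)

-- Strong Avoid with parameter k: C : [2^k] → [2^k + 1], each value written
-- with k+1 bits (bit j of C(i) is the variable (i , j)), little endian.

decode : {k : ℕ} → (Fin k → Bool) → ℕ
decode {zero}  b = 0
decode {suc k} b = (if b Fin.zero then 1 else 0) + 2 * decode {k} (λ j → b (Fin.suc j))
  where import Data.Fin as Fin

SAvoidVar : ℕ → Set
SAvoidVar k = Fin (2 ^ k) × Fin (suc k)

sAvoidSize : ℕ → ℕ
sAvoidSize k = 2 ^ k * suc k

sAvoid : (k : ℕ) → SearchProblem (SAvoidVar k) (Fin (2 ^ k + 1))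
sAvoid k C y = ∀ (i : Fin (2 ^ k)) → decode (λ j → C (i , j)) ≢ toℕ y

-- Linear Ordering Principle with parameter n: N = 2^n elements,
-- variable (i , j) true means i ≺ j.

LOPVar : ℕ → Set
LOPVar n = Fin (2 ^ n) × Fin (2 ^ n)

data LOPOut (N : ℕ) : Set where
  minimal    : Fin N → LOPOut N
  reflexive  : Fin N → LOPOut N
  incomp     : Fin N → Fin N → LOPOut N
  transFail  : Fin N → Fin N → Fin N → LOPOut N

LOP : (n : ℕ) → SearchProblem (LOPVar n) (LOPOut (2 ^ n))
LOP n x (minimal a)       = ∀ b → b ≢ a → x (a , b) ≡ true
LOP n x (reflexive a)     = x (a , a) ≡ true
LOP n x (incomp a b)      = a ≢ b × x (a , b) ≡ false × x (b , a) ≡ false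
LOP n x (transFail a b c) = (a ≢ b × b ≢ c × a ≢ c)
                            × x (a , b) ≡ true × x (b , c) ≡ true × x (a , c) ≡ false

LOPReducesWithin : ℕ → ℕ → Set
LOPReducesWithin n B =
  Σ' ℕ λ k → Σ' ℕ λ d → Formulation (LOP n) (sAvoid k) d × (⌈log₂ sAvoidSize k ⌉ + d ≤ B)
  where open import Data.Product renaming (Σ to Σ')

polylog : ℕ → ℕ → ℕ
polylog c L = c * ⌈log₂ L ⌉ ^ c + c

LOPSize : ℕ → ℕ
LOPSize n = 2 ^ n * 2 ^ n

LOP≤dt-sAvoid : Set
LOP≤dt-sAvoid = Σ' ℕ λ c → ∀ n → LOPReducesWithin n (polylog c (LOPSize n))
  where open import Data.Product renaming (Σ to Σ')

{-# OPTIONS --safe #-}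

-- Feed the reduction a uniformly random linear order of the N = 2 ^ n elements. For a candidate y
-- let q count the i with C(i) = y; if q = 0 then the output at y must be "minimal a" with a
-- the true minimum. Fix a, and let F(p) be the sum of [output at y is "minimal a"] (q - 1) over
-- the orders with a at position p. Then F(p) ≥ 0 for p > 0, and F is a polynomial of low degree:
-- elements that a decision tree path does not touch can be inserted last, and inserting one
-- preserves the degree. A low-degree F that is nonnegative at 1, …, N - 1 has a nonnegative sum
-- over 0, …, N - 1: take 2r-th differences of t ↦ F(c (t - r)²), whose largest coefficient is
-- the central one, and sum over c. Hence the sum of q - 1 over all orders is nonnegative for each
-- of the 2 ^ k + 1 values y, although for each order the q's add up to at most 2 ^ k.
module Submission where

open import Defs
open import Algebra.Bundles using (CommutativeRing)
open import Data.Bool using (Bool; true; false; if_then_else_)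
open import Data.Empty using (⊥-elim)
open import Data.Fin using (Fin; toℕ; fromℕ<; punchIn; _≟_)
open import Data.Fin.Properties using (toℕ<n; toℕ-fromℕ<; toℕ-injective; punchInᵢ≢i; any?)
open import Data.Integer using
  (ℤ; +_; -[1+_]; -_; _+_; _-_; _*_; _≤_; 0ℤ; 1ℤ; -1ℤ; _^_; ∣_∣; +≤+; -≤+; +<+; nonNegative; positive)
open import Data.Integer.Properties hiding (_≟_)
open import Data.Integer.Tactic.RingSolver using (solve-∀)
open import Data.List using (List; []; _∷_; length; _++_; allFin)
open import Data.List.Membership.DecPropositional using (_∈?_)
open import Data.List.Membership.Propositional using (_∈_; _∉_)
open import Data.List.Membership.Propositional.Properties using (∈-∃++; ∈-allFin)
open import Data.List.Properties using (++-identityʳ; length-tabulate)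
open import Data.List.Relation.Binary.Permutation.Propositional using
  (_↭_; ↭-refl; ↭-sym; ↭-trans; ↭-reflexive; ↭⇒↭ₛ; prep; swap)
open import Data.List.Relation.Binary.Permutation.Propositional.Properties using (↭-length; shift; ∈-resp-↭; ++⁺ʳ)
import Data.List.Relation.Binary.Permutation.Setoid.Properties as Permutationₛ
open import Data.List.Relation.Unary.AllPairs using (tail)
open import Data.List.Relation.Unary.Any using (here; there)
open import Data.List.Relation.Unary.Unique.Propositional using (Unique)
open import Data.List.Relation.Unary.Unique.Propositional.Properties using (Unique[x∷xs]⇒x∉xs; allFin⁺)
open import Data.Nat as ℕ using (ℕ; zero; suc; z≤n; s≤s)
open import Data.Nat.Combinatorics using (_C_; nCk+nC[k+1]≡[n+1]C[k+1]; nCk≡nC[n∸k]; nCn≡1)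
open import Data.Nat.Combinatorics.Specification using (k>n⇒nCk≡0)
open import Data.Nat.Logarithm using (⌈log₂_⌉; ⌈log₂⌉-mono-≤; ⌈log₂2^n⌉≡n)
import Data.Nat.Properties as ℕₚ
open import Data.Nat.Tactic.RingSolver using () renaming (solve-∀ to ℕ-solve-∀)
open import Data.Product using (∃; ∃₂; _×_; _,_)
open import Data.Sum using (_⊎_; [_,_]′; inj₁; inj₂)
open import Data.Vec.Functional using () renaming (_∷_ to _∷ᶠ_)
open import Function using (_∘_; id)
open import Relation.Binary.PropositionalEquality
open import Relation.Nullary using (¬_; Dec; does; yes; no)
open import Relation.Nullary.Decidable using (decidable-stable)

open import Algebra.Properties.Semiring.Sum (CommutativeRing.semiring +-*-commutativeRing) using
  (sum; sum-cong-≗; sum-remove; ∑-distrib-+; ∑-comm; *-distribˡ-sum; *-distribʳ-sum; sum-replicate-zero)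

-- Finite sums

∑ : ℕ → (ℕ → ℤ) → ℤ
∑ n f = sum {n} (f ∘ toℕ)

sum-mono : ∀ {n} {f g : Fin n → ℤ} → (∀ i → f i ≤ g i) → sum f ≤ sum g
sum-mono {zero}  f≤g = ≤-refl
sum-mono {suc n} f≤g = +-mono-≤ (f≤g Fin.zero) (sum-mono (f≤g ∘ Fin.suc))

sum-0 : ∀ {n} {f : Fin n → ℤ} → (∀ i → f i ≡ 0ℤ) → sum f ≡ 0ℤ
sum-0 {n} f≡0 = trans (sum-cong-≗ f≡0) (sum-replicate-zero n)

sum-const : ∀ n x → sum {n} (λ _ → x) ≡ + n * x
sum-const zero    x = sym (*-zeroˡ x)
sum-const (suc n) x = trans (cong (λ s → x + s) (sum-const n x)) (lem x (+ n))
  where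
  lem : ∀ x n → x + n * x ≡ (1ℤ + n) * x
  lem = solve-∀

sum-nonneg : ∀ {n} {f : Fin n → ℤ} → (∀ i → 0ℤ ≤ f i) → 0ℤ ≤ sum f
sum-nonneg {n} {f} 0≤f = subst (_≤ sum f) (sum-replicate-zero n) (sum-mono 0≤f)

∑-last : ∀ n f → ∑ (suc n) f ≡ ∑ n f + f n
∑-last zero    f = +-comm (f 0) 0ℤ
∑-last (suc n) f = trans (cong (λ s → f 0 + s) (∑-last n (f ∘ suc))) (sym (+-assoc (f 0) _ _))

∑-++ : ∀ m n f → ∑ (m ℕ.+ n) f ≡ ∑ m f + ∑ n (f ∘ (m ℕ.+_))
∑-++ zero    n f = sym (+-identityˡ _)
∑-++ (suc m) n f = trans (cong (λ s → f 0 + s) (∑-++ m n (f ∘ suc))) (sym (+-assoc (f 0) _ _))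

∑-+ : ∀ n (f g : ℕ → ℤ) → ∑ n (λ i → f i + g i) ≡ ∑ n f + ∑ n g
∑-+ n f g = ∑-distrib-+ {n} (f ∘ toℕ) (g ∘ toℕ)

∑-* : ∀ n x (f : ℕ → ℤ) → ∑ n (λ i → x * f i) ≡ x * ∑ n f
∑-* n x f = sym (*-distribˡ-sum {n} x (f ∘ toℕ))

∑-telescope : ∀ n (f : ℕ → ℤ) → ∑ n (λ i → f i - f (suc i)) ≡ f 0 - f n
∑-telescope zero    f = sym (+-inverseʳ (f 0))
∑-telescope (suc n) f = trans (cong (λ s → f 0 - f 1 + s) (∑-telescope n (f ∘ suc))) (lem (f 0) (f 1) (f (suc n)))
  where
  lem : ∀ x y z → x - y + (y - z) ≡ x - z
  lem = solve-∀

∑-cong : ∀ n {f g : ℕ → ℤ} → (∀ {i} → i ℕ.< n → f i ≡ g i) → ∑ n f ≡ ∑ n g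
∑-cong n f≡g = sum-cong-≗ {n} (λ i → f≡g (toℕ<n i))

-- Binomial coefficients

-- Induction on `n`: Pascal's rule splits the left side into terms covered by the hypotheses at `k`
-- and `k + 1`, and recombines the right side.
[k+1]*[n+1]C[k+1] : ∀ n k → suc k ℕ.* (suc n C suc k) ≡ suc n ℕ.* (n C k)
[k+1]*[n+1]C[k+1] zero    zero    = refl
[k+1]*[n+1]C[k+1] zero    (suc k) = trans (cong (suc (suc k) ℕ.*_) (k>n⇒nCk≡0 (s≤s (s≤s (z≤n {k})))))
                                    (trans (ℕₚ.*-zeroʳ k) (sym (trans (ℕₚ.*-identityˡ (0 C suc k)) (k>n⇒nCk≡0 (s≤s (z≤n {k}))))))
[k+1]*[n+1]C[k+1] (suc n) zero    = trans (ℕₚ.*-identityˡ _) (trans (sym (nCk+nC[k+1]≡[n+1]C[k+1] (suc n) 0))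
  (trans (cong suc (trans (sym (ℕₚ.*-identityˡ (suc n C 1))) ([k+1]*[n+1]C[k+1] n zero))) (lem n)))
  where
  lem : ∀ n → suc (suc n ℕ.* 1) ≡ suc (suc n) ℕ.* 1
  lem = ℕ-solve-∀
[k+1]*[n+1]C[k+1] (suc n) (suc k) = begin
  suc (suc k) ℕ.* (suc (suc n) C suc (suc k))
    ≡⟨ cong (suc (suc k) ℕ.*_) (sym (nCk+nC[k+1]≡[n+1]C[k+1] (suc n) (suc k))) ⟩
  suc (suc k) ℕ.* (suc n C suc k ℕ.+ suc n C suc (suc k))
    ≡⟨ lem₁ (suc k) (suc n C suc k) _ ⟩
  suc n C suc k ℕ.+ (suc k ℕ.* (suc n C suc k) ℕ.+ suc (suc k) ℕ.* (suc n C suc (suc k)))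
    ≡⟨ cong (suc n C suc k ℕ.+_) (cong₂ ℕ._+_ ([k+1]*[n+1]C[k+1] n k) ([k+1]*[n+1]C[k+1] n (suc k))) ⟩
  suc n C suc k ℕ.+ (suc n ℕ.* (n C k) ℕ.+ suc n ℕ.* (n C suc k))
    ≡⟨ cong (suc n C suc k ℕ.+_) (trans (sym (ℕₚ.*-distribˡ-+ (suc n) (n C k) _)) (cong (suc n ℕ.*_) (nCk+nC[k+1]≡[n+1]C[k+1] n k))) ⟩
  suc (suc n) ℕ.* (suc n C suc k) ∎
  where
  open ≡-Reasoning
  lem₁ : ∀ k x y → suc k ℕ.* (x ℕ.+ y) ≡ x ℕ.+ (k ℕ.* x ℕ.+ suc k ℕ.* y)
  lem₁ = ℕ-solve-∀

-- The absorption rule (k + 1) C(n, k + 1) = (n - k) C(n, k), with the negative term moved to the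
-- left to avoid truncated subtraction.
[k+1]*nC[k+1]+k*nCk : ∀ n k → suc k ℕ.* (n C suc k) ℕ.+ k ℕ.* (n C k) ≡ n ℕ.* (n C k)
[k+1]*nC[k+1]+k*nCk n k = ℕₚ.+-cancelˡ-≡ (n C k) _ _ (begin
  n C k ℕ.+ (suc k ℕ.* (n C suc k) ℕ.+ k ℕ.* (n C k))
    ≡⟨ lem (n C k) (n C suc k) k ⟩
  suc k ℕ.* (n C k ℕ.+ n C suc k)
    ≡⟨ cong (suc k ℕ.*_) (nCk+nC[k+1]≡[n+1]C[k+1] n k) ⟩
  suc k ℕ.* (suc n C suc k)
    ≡⟨ [k+1]*[n+1]C[k+1] n k ⟩
  n C k ℕ.+ n ℕ.* (n C k) ∎)
  where
  open ≡-Reasoning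
  lem : ∀ x y k → x ℕ.+ (suc k ℕ.* y ℕ.+ k ℕ.* x) ≡ suc k ℕ.* (x ℕ.+ y)
  lem = ℕ-solve-∀

-- Over `ℤ` the rule needs no bound on `k`. It produces each binomial from the previous one by a
-- linear factor in `n`, up to division by `k + 1`.
[k+1]*nC[k+1] : ∀ n k → + suc k * + (n C suc k) ≡ (+ n - + k) * + (n C k)
[k+1]*nC[k+1] n k = begin
  + suc k * + (n C suc k)
    ≡⟨ lem₁ _ (+ k * + (n C k)) ⟩
  + suc k * + (n C suc k) + + k * + (n C k) - + k * + (n C k)
    ≡⟨ cong (_- + k * + (n C k)) (trans (cong₂ _+_ (sym (pos-* (suc k) _)) (sym (pos-* k _))) (cong +_ ([k+1]*nC[k+1]+k*nCk n k))) ⟩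
  + (n ℕ.* (n C k)) - + k * + (n C k)
    ≡⟨ cong (_- + k * + (n C k)) (pos-* n _) ⟩
  + n * + (n C k) - + k * + (n C k)
    ≡⟨ lem₂ (+ n) (+ k) (+ (n C k)) ⟩
  (+ n - + k) * + (n C k) ∎
  where
  open ≡-Reasoning
  lem₁ : ∀ x y → x ≡ x + y - y
  lem₁ = solve-∀
  lem₂ : ∀ n k x → n * x - k * x ≡ (n - k) * x
  lem₂ = solve-∀

[n+1-k]*[n+1]Ck : ∀ n k → (+ suc n - + k) * + (suc n C k) ≡ + suc n * + (n C k)
[n+1-k]*[n+1]Ck n k = begin
  (+ suc n - + k) * + (suc n C k) ≡⟨ sym ([k+1]*nC[k+1] (suc n) k) ⟩
  + suc k * + (suc n C suc k)     ≡⟨ sym (pos-* (suc k) _) ⟩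
  + (suc k ℕ.* (suc n C suc k))   ≡⟨ cong +_ ([k+1]*[n+1]C[k+1] n k) ⟩
  + (suc n ℕ.* (n C k))           ≡⟨ pos-* (suc n) _ ⟩
  + suc n * + (n C k)             ∎
  where open ≡-Reasoning

-- The ratio of the two neighbours is (n - k) / (k + 1), which is at least 1 as soon as 2k + 1 ≤ n.
nCk≤nC[k+1] : ∀ n k → k ℕ.+ suc k ℕ.≤ n → n C k ℕ.≤ n C suc k
nCk≤nC[k+1] n k h = ℕₚ.*-cancelˡ-≤ (suc k) (ℕₚ.+-cancelʳ-≤ (k ℕ.* (n C k)) _ _ (begin
  suc k ℕ.* (n C k) ℕ.+ k ℕ.* (n C k) ≡⟨ lem k (n C k) ⟩
  (k ℕ.+ suc k) ℕ.* (n C k)           ≤⟨ ℕₚ.*-monoˡ-≤ (n C k) h ⟩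
  n ℕ.* (n C k)                       ≡⟨ sym ([k+1]*nC[k+1]+k*nCk n k) ⟩
  suc k ℕ.* (n C suc k) ℕ.+ k ℕ.* (n C k) ∎))
  where
  open ℕₚ.≤-Reasoning
  lem : ∀ k x → suc k ℕ.* x ℕ.+ k ℕ.* x ≡ (k ℕ.+ suc k) ℕ.* x
  lem = ℕ-solve-∀

-- Left of the centre the row increases step by step; the right half is reflected onto the left one.
centralBinomial-max : ∀ r {t} → t ℕ.≤ r ℕ.+ r → (r ℕ.+ r) C t ℕ.≤ (r ℕ.+ r) C r
centralBinomial-max r {t} t≤2r = [ below , above ]′ (ℕₚ.≤-total t r)
  where
  climb : ∀ t d → t ℕ.+ d ≡ r → (r ℕ.+ r) C t ℕ.≤ (r ℕ.+ r) C r
  climb t zero    eq = ℕₚ.≤-reflexive (cong ((r ℕ.+ r) C_) (trans (sym (ℕₚ.+-identityʳ t)) eq))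
  climb t (suc d) eq = ℕₚ.≤-trans (nCk≤nC[k+1] _ t (ℕₚ.+-mono-≤ (ℕₚ.<⇒≤ t<r) t<r))
                                  (climb (suc t) d (trans (sym (ℕₚ.+-suc t d)) eq))
    where
    t<r : t ℕ.< r
    t<r = subst (t ℕ.<_) eq (ℕₚ.m<m+n t (s≤s z≤n))
  below : ∀ {t} → t ℕ.≤ r → (r ℕ.+ r) C t ℕ.≤ (r ℕ.+ r) C r
  below {t} t≤r = climb t _ (ℕₚ.m+[n∸m]≡n t≤r)
  above : r ℕ.≤ t → (r ℕ.+ r) C t ℕ.≤ (r ℕ.+ r) C r
  above r≤t = subst (ℕ._≤ (r ℕ.+ r) C r) (sym (nCk≡nC[n∸k] t≤2r))
    (below (ℕₚ.≤-trans (ℕₚ.∸-monoʳ-≤ (r ℕ.+ r) r≤t) (ℕₚ.≤-reflexive (ℕₚ.m+n∸n≡m r r))))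

-- Finite differences

Δ : (ℕ → ℤ) → ℕ → ℤ
Δ g t = g (suc t) - g t

-- Stands for "polynomial of degree less than m". Only the vanishing m-th difference is recorded, so
-- closure properties follow by induction on m without handling coefficients.
data VanishingΔ : ℕ → (ℕ → ℤ) → Set where
  base : ∀ {g} → (∀ t → g t ≡ 0ℤ) → VanishingΔ zero g
  step : ∀ {m g} → VanishingΔ m (Δ g) → VanishingΔ (suc m) g

VanishingΔ-cong : ∀ {m f g} → f ≗ g → VanishingΔ m f → VanishingΔ m g
VanishingΔ-cong f≗g (base h) = base (λ t → trans (sym (f≗g t)) (h t))
VanishingΔ-cong f≗g (step h) = step (VanishingΔ-cong (λ t → cong₂ _-_ (f≗g (suc t)) (f≗g t)) h)

VanishingΔ-suc : ∀ {m g} → VanishingΔ m g → VanishingΔ (suc m) g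
VanishingΔ-suc (base h) = step (base (λ t → cong₂ _-_ (h (suc t)) (h t)))
VanishingΔ-suc (step h) = step (VanishingΔ-suc h)

VanishingΔ-≤ : ∀ {m n g} → m ℕ.≤ n → VanishingΔ m g → VanishingΔ n g
VanishingΔ-≤ {m} {g = g} m≤n h = go (ℕₚ.≤⇒≤′ m≤n)
  where
  go : ∀ {n} → m ℕ.≤′ n → VanishingΔ n g
  go (ℕ.≤′-reflexive refl) = h
  go (ℕ.≤′-step m≤n)       = VanishingΔ-suc (go m≤n)

VanishingΔ-+ : ∀ {m f g} → VanishingΔ m f → VanishingΔ m g → VanishingΔ m (λ t → f t + g t)
VanishingΔ-+ (base hf) (base hg) = base (λ t → cong₂ _+_ (hf t) (hg t))
VanishingΔ-+ {f = f} {g} (step hf) (step hg) =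
  step (VanishingΔ-cong (λ t → lem (f (suc t)) (f t) (g (suc t)) (g t)) (VanishingΔ-+ hf hg))
  where
  lem : ∀ a b c d → (a - b) + (c - d) ≡ (a + c) - (b + d)
  lem = solve-∀

VanishingΔ-* : ∀ x {m g} → VanishingΔ m g → VanishingΔ m (λ t → x * g t)
VanishingΔ-* x         (base h) = base (λ t → trans (cong (x *_) (h t)) (*-zeroʳ x))
VanishingΔ-* x {g = g} (step h) = step (VanishingΔ-cong (λ t → lem x (g (suc t)) (g t)) (VanishingΔ-* x h))
  where
  lem : ∀ x a b → x * (a - b) ≡ x * a - x * b
  lem = solve-∀

-- Binomials are integer-valued, but as polynomials they have rational coefficients; cancelling a
-- positive factor replaces the division.
VanishingΔ-*-cancel : ∀ n {m g} → VanishingΔ m (λ t → + suc n * g t) → VanishingΔ m g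
VanishingΔ-*-cancel n {g = g} (base h) =
  base (λ t → *-cancelˡ-≡ (+ suc n) (g t) 0ℤ (trans (h t) (sym (*-zeroʳ (+ suc n)))))
VanishingΔ-*-cancel n {g = g} (step h) =
  step (VanishingΔ-*-cancel n (VanishingΔ-cong (λ t → lem (+ suc n) (g (suc t)) (g t)) h))
  where
  lem : ∀ x a b → x * a - x * b ≡ x * (a - b)
  lem = solve-∀

VanishingΔ-shift : ∀ {m g} → VanishingΔ m g → VanishingΔ m (g ∘ suc)
VanishingΔ-shift (base h) = base (h ∘ suc)
VanishingΔ-shift (step h) = step (VanishingΔ-shift h)

VanishingΔ-t* : ∀ {m g} → VanishingΔ m g → VanishingΔ (suc m) (λ t → + t * g t)
VanishingΔ-t* (base h) = step (base (λ t → trans (cong₂ (λ a b → + suc t * a - + t * b) (h (suc t)) (h t)) (lem (+ t))))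
  where
  lem : ∀ t → (1ℤ + t) * 0ℤ - t * 0ℤ ≡ 0ℤ
  lem = solve-∀
-- Product rule: the difference of t g(t) is t Δg(t) + g(t + 1).
VanishingΔ-t* {g = g} (step h) =
  step (VanishingΔ-cong (λ t → lem (+ t) (g (suc t)) (g t)) (VanishingΔ-+ (VanishingΔ-t* h) (VanishingΔ-shift {g = g} (step h))))
  where
  lem : ∀ t a b → t * (a - b) + a ≡ (1ℤ + t) * a - t * b
  lem = solve-∀

VanishingΔ-linear* : ∀ a {m g} → VanishingΔ m g → VanishingΔ (suc m) (λ t → (+ t - a) * g t)
VanishingΔ-linear* a {g = g} h =
  VanishingΔ-cong (λ t → lem a (+ t) (g t)) (VanishingΔ-+ (VanishingΔ-t* h) (VanishingΔ-* (- a) (VanishingΔ-suc h)))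
  where
  lem : ∀ a t x → t * x + (- a) * x ≡ (t - a) * x
  lem = solve-∀

∣i∣*∣i∣≡i*i : ∀ i → + (∣ i ∣ ℕ.* ∣ i ∣) ≡ i * i
∣i∣*∣i∣≡i*i (+ n)          = pos-* n n
∣i∣*∣i∣≡i*i -[1+ n ] = refl

dist : ℕ → ℕ → ℕ
dist r t = ∣ + t - + r ∣

-- With x = c (t - r)², the recurrence (j + 1) C(x, j + 1) = (x - j) C(x, j) raises the degree in t
-- by two at each step, so C(x, j) has degree at most 2j.
VanishingΔ-dist²-binomial : ∀ c r j → VanishingΔ (suc (j ℕ.+ j)) (λ t → + ((c ℕ.* (dist r t ℕ.* dist r t)) C j))
VanishingΔ-dist²-binomial c r zero    = step (base (λ _ → refl))
VanishingΔ-dist²-binomial c r (suc j) =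
  subst (λ m → VanishingΔ (suc (suc m)) (λ t → + (x t C suc j))) (sym (ℕₚ.+-suc j j))
    (VanishingΔ-*-cancel j (VanishingΔ-cong recurrence
      (VanishingΔ-+ (VanishingΔ-* (+ c) (VanishingΔ-linear* (+ r) (VanishingΔ-linear* (+ r) IH)))
                    (VanishingΔ-* (- + j) (VanishingΔ-suc (VanishingΔ-suc IH))))))
  where
  x : ℕ → ℕ
  x t = c ℕ.* (dist r t ℕ.* dist r t)
  IH : VanishingΔ (suc (j ℕ.+ j)) (λ t → + (x t C j))
  IH = VanishingΔ-dist²-binomial c r j
  lem : ∀ c t r j b → c * ((t - r) * ((t - r) * b)) + (- j) * b ≡ (c * ((t - r) * (t - r)) - j) * b
  lem = solve-∀
  recurrence : ∀ t → + c * ((+ t - + r) * ((+ t - + r) * + (x t C j))) + (- + j) * + (x t C j)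
                   ≡ + suc j * + (x t C suc j)
  recurrence t = trans (lem (+ c) (+ t) (+ r) (+ j) (+ (x t C j)))
    (trans (cong (λ s → (s - + j) * + (x t C j))
             (trans (cong (λ s → + c * s) (sym (∣i∣*∣i∣≡i*i (+ t - + r)))) (sym (pos-* c (dist r t ℕ.* dist r t)))))
      (sym ([k+1]*nC[k+1] (x t) j)))

VanishingΔ-∑ : ∀ {m} n (f : ℕ → ℕ → ℤ) → (∀ {j} → j ℕ.< n → VanishingΔ m (f j)) → VanishingΔ m (λ t → ∑ n (λ j → f j t))
VanishingΔ-∑ zero    f h = VanishingΔ-≤ z≤n (base (λ _ → refl))
VanishingΔ-∑ (suc n) f h = VanishingΔ-+ (h (s≤s z≤n)) (VanishingΔ-∑ n (f ∘ suc) (h ∘ s≤s))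

-- The coefficients of the n-th difference at 0. The usual exponent n - t is replaced by n + t,
-- which has the same parity.
signedBinomial : ℕ → ℕ → ℤ
signedBinomial n t = -1ℤ ^ (n ℕ.+ t) * + (n C t)

-- The sum is the n-th difference of `g` at 0. By Pascal's rule the sum of order n + 1 for `g` is
-- that of order n for `Δ g` plus a telescoping part; what telescoping leaves cancels the term at 0,
-- because n C (n + 1) is 0.
∑-signedBinomial : ∀ {n g} → VanishingΔ n g → ∑ (suc n) (λ t → signedBinomial n t * g t) ≡ 0ℤ
∑-signedBinomial {g = g} (base h) = trans (+-identityʳ (1ℤ * g 0)) (cong (1ℤ *_) (h 0))
∑-signedBinomial {suc n} {g} (step h) = begin
  B′ 0 * g 0 + ∑ (suc n) (λ t → B′ (suc t) * g (suc t))
    ≡⟨ cong₂ _+_ (lem₀ (-1ℤ ^ (n ℕ.+ 0)) (g 0)) (∑-cong (suc n) (λ {t} _ → pascal t)) ⟩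
  - 1ℤ * (B 0 * g 0) + ∑ (suc n) (λ t → B t * Δ g t + (B t * g t - B (suc t) * g (suc t)))
    ≡⟨ cong (λ s → - 1ℤ * (B 0 * g 0) + s) (∑-+ (suc n) (λ t → B t * Δ g t) (λ t → B t * g t - B (suc t) * g (suc t))) ⟩
  - 1ℤ * (B 0 * g 0) + (∑ (suc n) (λ t → B t * Δ g t) + ∑ (suc n) (λ t → B t * g t - B (suc t) * g (suc t)))
    ≡⟨ cong₂ (λ s s′ → - 1ℤ * (B 0 * g 0) + (s + s′)) (∑-signedBinomial h) (∑-telescope (suc n) (λ t → B t * g t)) ⟩
  - 1ℤ * (B 0 * g 0) + (0ℤ + (B 0 * g 0 - B (suc n) * g (suc n)))
    ≡⟨ cong (λ s → - 1ℤ * (B 0 * g 0) + (0ℤ + (B 0 * g 0 - s * g (suc n)))) B-last ⟩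
  - 1ℤ * (B 0 * g 0) + (0ℤ + (B 0 * g 0 - 0ℤ * g (suc n)))
    ≡⟨ lem₂ (B 0 * g 0) (g (suc n)) ⟩
  0ℤ ∎
  where
  open ≡-Reasoning
  B  = signedBinomial n
  B′ = signedBinomial (suc n)
  lem₀ : ∀ s x → (-1ℤ * s) * 1ℤ * x ≡ - 1ℤ * (s * 1ℤ * x)
  lem₀ = solve-∀
  lem₁ : ∀ s p q x y → (-1ℤ * (-1ℤ * s)) * (p + q) * x ≡ s * p * (x - y) + (s * p * y - (-1ℤ * s) * q * x)
  lem₁ = solve-∀
  lem₂ : ∀ a x → - 1ℤ * a + (0ℤ + (a - 0ℤ * x)) ≡ 0ℤ
  lem₂ = solve-∀
  pascal : ∀ t → B′ (suc t) * g (suc t) ≡ B t * Δ g t + (B t * g t - B (suc t) * g (suc t))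
  pascal t = begin
    -1ℤ ^ (suc n ℕ.+ suc t) * + (suc n C suc t) * g (suc t)
      ≡⟨ cong₂ (λ e b → -1ℤ ^ suc e * + b * g (suc t)) (ℕₚ.+-suc n t) (sym (nCk+nC[k+1]≡[n+1]C[k+1] n t)) ⟩
    -1ℤ ^ suc (suc (n ℕ.+ t)) * (+ (n C t) + + (n C suc t)) * g (suc t)
      ≡⟨ lem₁ (-1ℤ ^ (n ℕ.+ t)) (+ (n C t)) (+ (n C suc t)) (g (suc t)) (g t) ⟩
    B t * Δ g t + (B t * g t - -1ℤ ^ suc (n ℕ.+ t) * + (n C suc t) * g (suc t))
      ≡⟨ cong (λ e → B t * Δ g t + (B t * g t - -1ℤ ^ e * + (n C suc t) * g (suc t))) (sym (ℕₚ.+-suc n t)) ⟩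
    B t * Δ g t + (B t * g t - B (suc t) * g (suc t)) ∎
  B-last : B (suc n) ≡ 0ℤ
  B-last = trans (cong (λ b → -1ℤ ^ (n ℕ.+ suc n) * + b) (k>n⇒nCk≡0 (ℕₚ.n<1+n n))) (*-zeroʳ (-1ℤ ^ (n ℕ.+ suc n)))

-- Low-degree functions that are nonnegative away from 0

-- Newton form with integer coefficients in the basis `p C j`. It is required only for `p ≤ n`: the
-- functions of interest depend on a position in a list of length `n`, and are not polynomial past
-- its end.
record DegreeAtMost (u n : ℕ) (F : ℕ → ℤ) : Set where
  constructor newton
  field
    coefficient : ℕ → ℤ
    expansion   : ∀ {p} → p ℕ.≤ n → F p ≡ ∑ (suc u) (λ j → coefficient j * + (p C j))

dist-≤ : ∀ {r t} → t ℕ.≤ r ℕ.+ r → dist r t ℕ.≤ r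
dist-≤ {r} {t} t≤2r with ℕₚ.≤-total r t
... | inj₁ r≤t = subst (ℕ._≤ r) (sym (cong ∣_∣ (trans (m-n≡m⊖n t r) (⊖-≥ r≤t))))
                   (ℕₚ.≤-trans (ℕₚ.∸-monoˡ-≤ r t≤2r) (ℕₚ.≤-reflexive (ℕₚ.m+n∸n≡m r r)))
... | inj₂ t≤r = subst (ℕ._≤ r) (sym (trans (cong ∣_∣ (m-n≡m⊖n t r)) (∣⊖∣-≤ t≤r))) (ℕₚ.m∸n≤m r t)

dist-refl : ∀ r → dist r r ≡ 0
dist-refl r = cong ∣_∣ (+-inverseʳ (+ r))

dist≡0⇒≡ : ∀ {r t} → dist r t ≡ 0 → t ≡ r
dist≡0⇒≡ {r} {t} eq = +-injective (i-j≡0⇒i≡j (+ t) (+ r) (∣i∣≡0⇒i≡0 eq))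

dist²≢0 : ∀ {r t} → t ≢ r → dist r t ℕ.* dist r t ≢ 0
dist²≢0 {r} {t} t≢r eq = t≢r (dist≡0⇒≡ {r} {t} ([ id , id ]′ (ℕₚ.m*n≡0⇒m≡0∨n≡0 (dist r t) eq)))

-1^[k+k] : ∀ k → -1ℤ ^ (k ℕ.+ k) ≡ 1ℤ
-1^[k+k] zero    = refl
-1^[k+k] (suc k) = trans (cong (λ e → -1ℤ ^ suc e) (ℕₚ.+-suc k k)) (trans (lem (-1ℤ ^ (k ℕ.+ k))) (-1^[k+k] k))
  where
  lem : ∀ x → -1ℤ * (-1ℤ * x) ≡ x
  lem = solve-∀

-1^-sign : ∀ k → -1ℤ ^ k ≡ 1ℤ ⊎ -1ℤ ^ k ≡ -1ℤ
-1^-sign zero    = inj₁ refl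
-1^-sign (suc k) = [ (λ eq → inj₂ (cong (-1ℤ *_) eq)) , (λ eq → inj₁ (cong (-1ℤ *_) eq)) ]′ (-1^-sign k)

signedBinomial-≤ : ∀ n t → signedBinomial n t ≤ + (n C t)
signedBinomial-≤ n t with -1^-sign (n ℕ.+ t)
... | inj₁ eq = ≤-reflexive (trans (cong (_* + (n C t)) eq) (*-identityˡ (+ (n C t))))
... | inj₂ eq = ≤-trans (≤-reflexive (trans (cong (_* + (n C t)) eq) (-1*i≡-i (+ (n C t))))) (neg-≤-pos {n C t})

-- The parity of the radius makes the central coefficient positive, hence the largest one.
signedBinomial-central : ∀ e → let r = e ℕ.+ e in signedBinomial (r ℕ.+ r) r ≡ + ((r ℕ.+ r) C r)
signedBinomial-central e = trans (cong (_* + ((r ℕ.+ r) C r)) sign) (*-identityˡ (+ ((r ℕ.+ r) C r)))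
  where
  r = e ℕ.+ e
  lem : ∀ e → (e ℕ.+ e) ℕ.+ (e ℕ.+ e) ℕ.+ (e ℕ.+ e) ≡ (e ℕ.+ e ℕ.+ e) ℕ.+ (e ℕ.+ e ℕ.+ e)
  lem = ℕ-solve-∀
  sign : -1ℤ ^ (r ℕ.+ r ℕ.+ r) ≡ 1ℤ
  sign = trans (cong (-1ℤ ^_) (lem e)) (-1^[k+k] (e ℕ.+ e ℕ.+ e))

nCk>0 : ∀ {n k} → k ℕ.≤ n → 0 ℕ.< n C k
nCk>0 {n}     {zero}  _         = s≤s z≤n
nCk>0 {suc n} {suc k} (s≤s k≤n) =
  subst (0 ℕ.<_) (nCk+nC[k+1]≡[n+1]C[k+1] n k) (ℕₚ.≤-trans (nCk>0 k≤n) (ℕₚ.m≤m+n (n C k) _))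

0≤* : ∀ {x y} → 0ℤ ≤ x → 0ℤ ≤ y → 0ℤ ≤ x * y
0≤* {x} {y} 0≤x 0≤y = ≤-trans (≤-reflexive (sym (*-zeroʳ x))) (*-monoˡ-≤-nonNeg x {{nonNegative 0≤x}} 0≤y)

-- The signed sum of `g` vanishes, so subtracting it from β times the plain sum changes nothing,
-- where β is the central coefficient. The new weights β - B(t) are nonnegative, and zero at the
-- centre, where `g` may be negative.
∑-nonneg-off-centre : ∀ e g → let r = e ℕ.+ e in VanishingΔ (r ℕ.+ r) g →
  (∀ {t} → t ℕ.≤ r ℕ.+ r → t ≢ r → 0ℤ ≤ g t) → 0ℤ ≤ ∑ (suc (r ℕ.+ r)) g
∑-nonneg-off-centre e g vanish g≥0 =
  *-cancelˡ-≤-pos 0ℤ (∑ (suc 2r) g) β {{positive (+<+ (nCk>0 (ℕₚ.m≤m+n r r)))}}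
    (≤-trans (≤-reflexive (*-zeroʳ β)) (≤-trans weighted (≤-reflexive split)))
  where
  r = e ℕ.+ e
  2r = r ℕ.+ r
  β = + (2r C r)
  B = signedBinomial 2r
  lem : ∀ β b x → (β - b) * x ≡ β * x + -1ℤ * (b * x)
  lem = solve-∀
  split : ∑ (suc 2r) (λ t → (β - B t) * g t) ≡ β * ∑ (suc 2r) g
  split = begin
    ∑ (suc 2r) (λ t → (β - B t) * g t)
      ≡⟨ ∑-cong (suc 2r) (λ {t} _ → lem β (B t) (g t)) ⟩
    ∑ (suc 2r) (λ t → β * g t + -1ℤ * (B t * g t))
      ≡⟨ ∑-+ (suc 2r) (λ t → β * g t) (λ t → -1ℤ * (B t * g t)) ⟩
    ∑ (suc 2r) (λ t → β * g t) + ∑ (suc 2r) (λ t → -1ℤ * (B t * g t))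
      ≡⟨ cong₂ _+_ (∑-* (suc 2r) β g) (trans (∑-* (suc 2r) -1ℤ (λ t → B t * g t)) (cong (-1ℤ *_) (∑-signedBinomial vanish))) ⟩
    β * ∑ (suc 2r) g + 0ℤ
      ≡⟨ +-identityʳ (β * ∑ (suc 2r) g) ⟩
    β * ∑ (suc 2r) g ∎
    where open ≡-Reasoning
  term : ∀ t → t ℕ.≤ 2r → 0ℤ ≤ (β - B t) * g t
  term t t≤2r with t ℕ.≟ r
  ... | yes refl = ≤-reflexive (sym (trans (cong (_* g r) (i≡j⇒i-j≡0 (sym (signedBinomial-central e)))) (*-zeroˡ (g r))))
  ... | no t≢r   = 0≤* (i≤j⇒0≤j-i (≤-trans (signedBinomial-≤ 2r t) (+≤+ (centralBinomial-max r t≤2r)))) (g≥0 t≤2r t≢r)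
  weighted : 0ℤ ≤ ∑ (suc 2r) (λ t → (β - B t) * g t)
  weighted = sum-nonneg {suc 2r} (λ i → term (toℕ i) (ℕₚ.≤-pred (toℕ<n i)))

-- F sampled at c (t - r)² is a polynomial in t whose only possibly negative value is the central one.
∑-squares-nonneg : ∀ {u n F} → DegreeAtMost u n F → (∀ {h} → 0 ℕ.< h → h ℕ.≤ n → 0ℤ ≤ F h) →
  ∀ c → 0 ℕ.< c → let r = suc u ℕ.+ suc u in c ℕ.* (r ℕ.* r) ℕ.≤ n →
  0ℤ ≤ ∑ (suc (r ℕ.+ r)) (λ t → F (c ℕ.* (dist r t ℕ.* dist r t)))
∑-squares-nonneg {u} {n} {F} (newton a F≡) F≥0 c 0<c cr²≤n =
  subst (0ℤ ≤_) (∑-cong (suc (r ℕ.+ r)) (λ t<1+2r → sym (F≡ (x≤n (ℕₚ.≤-pred t<1+2r)))))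
    (∑-nonneg-off-centre (suc u) g
      (VanishingΔ-≤ bound (VanishingΔ-∑ (suc u) (λ j t → a j * + (x t C j)) λ {j} j≤u →
        VanishingΔ-* (a j) (VanishingΔ-≤ (s≤s (ℕₚ.+-mono-≤ (ℕₚ.≤-pred j≤u) (ℕₚ.≤-pred j≤u))) (VanishingΔ-dist²-binomial c r j))))
      (λ {t} t≤2r t≢r → subst (0ℤ ≤_) (F≡ (x≤n t≤2r))
        (F≥0 (ℕₚ.n≢0⇒n>0 λ eq → [ ℕₚ.m<n⇒n≢0 0<c , dist²≢0 {r} t≢r ]′ (ℕₚ.m*n≡0⇒m≡0∨n≡0 c eq)) (x≤n t≤2r))))
  where
  -- As a double, `r` is even; and 2r exceeds the degree 2u of `g` in t, so its 2r-th difference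
  -- vanishes.
  r = suc u ℕ.+ suc u
  x : ℕ → ℕ
  x t = c ℕ.* (dist r t ℕ.* dist r t)
  g : ℕ → ℤ
  g t = ∑ (suc u) (λ j → a j * + (x t C j))
  x≤n : ∀ {t} → t ℕ.≤ r ℕ.+ r → x t ℕ.≤ n
  x≤n {t} t≤2r = ℕₚ.≤-trans (ℕₚ.*-monoʳ-≤ c (ℕₚ.*-mono-≤ (dist-≤ {r} {t} t≤2r) (dist-≤ {r} {t} t≤2r))) cr²≤n
  bound : suc (u ℕ.+ u) ℕ.≤ r ℕ.+ r
  bound = ℕₚ.≤-trans (ℕₚ.+-monoʳ-≤ (suc u) (ℕₚ.n≤1+n u)) (ℕₚ.m≤m+n r r)

-- The range is cut into blocks of length `suc q`, and only the last entry of each block is kept.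
-- With `H = F ∘ suc` these entries are the values of `F` at the multiples of `suc q`.
∑-multiples-≤ : ∀ m q H → (∀ {p} → p ℕ.< m ℕ.* suc q → 0ℤ ≤ H p) →
  ∑ m (λ i → H (q ℕ.+ i ℕ.* suc q)) ≤ ∑ (m ℕ.* suc q) H
∑-multiples-≤ zero    q H H≥0 = ≤-refl
∑-multiples-≤ (suc m) q H H≥0 = begin
  H (q ℕ.+ 0) + ∑ m (λ i → H (q ℕ.+ suc i ℕ.* suc q))
    ≡⟨ cong₂ _+_ (cong H (ℕₚ.+-identityʳ q)) (∑-cong m λ {i} _ → cong H (lem q (i ℕ.* suc q))) ⟩
  H q + ∑ m (λ i → H (suc q ℕ.+ (q ℕ.+ i ℕ.* suc q)))
    ≤⟨ +-mono-≤ block (∑-multiples-≤ m q (H ∘ (suc q ℕ.+_)) (H≥0 ∘ ℕₚ.+-monoʳ-< (suc q))) ⟩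
  ∑ (suc q) H + ∑ (m ℕ.* suc q) (H ∘ (suc q ℕ.+_))
    ≡⟨ sym (∑-++ (suc q) (m ℕ.* suc q) H) ⟩
  ∑ (suc m ℕ.* suc q) H ∎
  where
  open ≤-Reasoning
  lem : ∀ q y → q ℕ.+ suc (q ℕ.+ y) ≡ suc q ℕ.+ (q ℕ.+ y)
  lem = ℕ-solve-∀
  block : H q ≤ ∑ (suc q) H
  block = ≤-trans (≤-reflexive (sym (+-identityˡ (H q)))) (≤-trans
    (+-monoˡ-≤ (H q) (sum-nonneg {q} λ i → H≥0 (ℕₚ.≤-trans (ℕₚ.m<n⇒m<1+n (toℕ<n i)) (ℕₚ.m≤m+n (suc q) _))))
    (≤-reflexive (sym (∑-last q H))))

∑-mono-≤ : ∀ {m n} H → m ℕ.≤ n → (∀ {p} → p ℕ.< n → 0ℤ ≤ H p) → ∑ m H ≤ ∑ n H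
∑-mono-≤ {m} {n} H m≤n H≥0 = begin
  ∑ m H                                    ≡⟨ sym (+-identityʳ (∑ m H)) ⟩
  ∑ m H + 0ℤ                               ≤⟨ +-monoʳ-≤ (∑ m H) (sum-nonneg {n ℕ.∸ m} λ i → H≥0 (in-range i)) ⟩
  ∑ m H + ∑ (n ℕ.∸ m) (H ∘ (m ℕ.+_))       ≡⟨ sym (∑-++ m (n ℕ.∸ m) H) ⟩
  ∑ (m ℕ.+ (n ℕ.∸ m)) H                    ≡⟨ cong (λ k → ∑ k H) (ℕₚ.m+[n∸m]≡n m≤n) ⟩
  ∑ n H                                    ∎
  where
  open ≤-Reasoning
  in-range : ∀ (i : Fin (n ℕ.∸ m)) → m ℕ.+ toℕ i ℕ.< n
  in-range i = subst (m ℕ.+ toℕ i ℕ.<_) (ℕₚ.m+[n∸m]≡n m≤n) (ℕₚ.+-monoʳ-< m (toℕ<n i))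

-- Summing over the dilation c, a point h > 0 is sampled at most once for each t.
∑-nonneg-of-tail : ∀ {u n F} → DegreeAtMost u n F → (∀ {h} → 0 ℕ.< h → h ℕ.≤ n → 0ℤ ≤ F h) →
  (let r = suc u ℕ.+ suc u) → (r ℕ.+ r) ℕ.* (r ℕ.* r) ℕ.≤ n → 0ℤ ≤ ∑ (suc n) F
∑-nonneg-of-tail {u} {n} {F} deg F≥0 2r³≤n =
  *-cancelˡ-≤-pos 0ℤ (F 0 + S) (+ K) (≤-trans (≤-reflexive (*-zeroʳ (+ K))) (begin
    0ℤ
      ≤⟨ sum-nonneg {K} (λ i → ∑-squares-nonneg {u} {n} {F} deg F≥0 (suc (toℕ i)) (s≤s z≤n)
           (ℕₚ.≤-trans (ℕₚ.*-monoˡ-≤ (r ℕ.* r) (toℕ<n i)) 2r³≤n)) ⟩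
    ∑ K (λ i → ∑ (suc K) (λ t → G t i))
      ≡⟨ ∑-comm {K} {suc K} (λ i t → G (toℕ t) (toℕ i)) ⟩
    ∑ (suc K) (λ t → ∑ K (G t))
      ≡⟨ sum-remove {K} {centre} (λ t → ∑ K (G (toℕ t))) ⟩
    ∑ K (G (toℕ centre)) + sum {K} (λ j → ∑ K (G (toℕ (punchIn centre j))))
      ≤⟨ +-mono-≤ (≤-reflexive central) (sum-mono {K} λ j → off-centre (toℕ (punchIn centre j))
           (ℕₚ.≤-pred (toℕ<n (punchIn centre j)))
           (λ eq → punchInᵢ≢i centre j (toℕ-injective (trans eq (sym toℕ-centre))))) ⟩
    + K * F 0 + sum {K} (λ _ → S)
      ≡⟨ cong (λ s → + K * F 0 + s) (sum-const K S) ⟩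
    + K * F 0 + + K * S
      ≡⟨ sym (*-distribˡ-+ (+ K) (F 0) S) ⟩
    + K * (F 0 + S) ∎))
  where
  open ≤-Reasoning
  r = suc u ℕ.+ suc u
  -- There are 2r off-centre values of t, each contributing at most `S`. Taking equally many
  -- dilations c yields as many copies of `F 0`, so the common factor `K` cancels. The largest point
  -- sampled is `K` times r².
  K = r ℕ.+ r
  S = ∑ n (F ∘ suc)
  G : ℕ → ℕ → ℤ
  G t i = F (suc i ℕ.* (dist r t ℕ.* dist r t))
  r<1+K : r ℕ.< suc K
  r<1+K = s≤s (ℕₚ.m≤m+n r r)
  centre : Fin (suc K)
  centre = fromℕ< r<1+K
  toℕ-centre : toℕ centre ≡ r
  toℕ-centre = toℕ-fromℕ< r<1+K
  central : ∑ K (G (toℕ centre)) ≡ + K * F 0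
  central = trans (∑-cong K λ {i} _ → cong F (trans (cong (λ d → suc i ℕ.* (d ℕ.* d))
    (trans (cong (dist r) toℕ-centre) (dist-refl r))) (ℕₚ.*-zeroʳ (suc i)))) (sum-const K (F 0))
  off-centre : ∀ t → t ℕ.≤ K → t ≢ r → ∑ K (G t) ≤ S
  -- Off the centre the square is some `suc q`, so the points sampled for this t are distinct
  -- positive multiples of it.
  off-centre t t≤K t≢r with dist r t ℕ.* dist r t in eq
  ... | zero  = ⊥-elim (dist²≢0 {r} t≢r eq)
  ... | suc q = ≤-trans (∑-multiples-≤ K q (F ∘ suc) (λ p<Kq → F≥0 (s≤s z≤n) (ℕₚ.≤-trans p<Kq Kq≤n)))
                        (∑-mono-≤ (F ∘ suc) Kq≤n (F≥0 (s≤s z≤n)))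
    where
    Kq≤n : K ℕ.* suc q ℕ.≤ n
    Kq≤n = ℕₚ.≤-trans (ℕₚ.*-monoʳ-≤ K (subst (ℕ._≤ r ℕ.* r) eq (ℕₚ.*-mono-≤ (dist-≤ {r} {t} t≤K) (dist-≤ {r} {t} t≤K)))) 2r³≤n

-- Sums over the linear orders of a list

module _ {A : Set} where

  insertAt : ℕ → A → List A → List A
  insertAt zero    a τ       = a ∷ τ
  insertAt (suc p) a []      = a ∷ []
  insertAt (suc p) a (t ∷ τ) = t ∷ insertAt p a τ

  insertSum : A → List A → (List A → ℤ) → ℤ
  insertSum a τ G = ∑ (suc (length τ)) (λ p → G (insertAt p a τ))

  -- An unnormalised expectation over random orders, with the head of the list inserted last.
  -- Integer sums suffice because only signs matter.
  permSum : List A → (List A → ℤ) → ℤ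
  permSum []       G = G []
  permSum (a ∷ as) G = permSum as (λ τ → insertSum a τ G)

  insertAt-↭ : ∀ p a τ → insertAt p a τ ↭ a ∷ τ
  insertAt-↭ zero    a τ       = ↭-refl
  insertAt-↭ (suc p) a []      = ↭-refl
  insertAt-↭ (suc p) a (t ∷ τ) = ↭-trans (prep t (insertAt-↭ p a τ)) (swap t a ↭-refl)

  permSum-mono : ∀ W {G H} → (∀ {τ} → τ ↭ W → G τ ≤ H τ) → permSum W G ≤ permSum W H
  permSum-mono []       G≤H = G≤H ↭-refl
  permSum-mono (a ∷ as) {G} {H} G≤H = permSum-mono as λ {τ} τ↭as →
    sum-mono {suc (length τ)} {λ p → G (insertAt (toℕ p) a τ)} {λ p → H (insertAt (toℕ p) a τ)}
      λ p → G≤H (↭-trans (insertAt-↭ (toℕ p) a τ) (prep a τ↭as))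

  permSum-cong : ∀ W {G H} → (∀ {τ} → τ ↭ W → G τ ≡ H τ) → permSum W G ≡ permSum W H
  permSum-cong W G≡H = ≤-antisym (permSum-mono W (≤-reflexive ∘ G≡H)) (permSum-mono W (≤-reflexive ∘ sym ∘ G≡H))

  permSum-+ : ∀ W G H → permSum W (λ τ → G τ + H τ) ≡ permSum W G + permSum W H
  permSum-+ []       G H = refl
  permSum-+ (a ∷ as) G H = trans
    (permSum-cong as λ {τ} _ → ∑-+ (suc (length τ)) (λ p → G (insertAt p a τ)) (λ p → H (insertAt p a τ)))
    (permSum-+ as (λ τ → insertSum a τ G) (λ τ → insertSum a τ H))

  permSum-* : ∀ W x G → permSum W (λ τ → x * G τ) ≡ x * permSum W G
  permSum-* []       x G = refl
  permSum-* (a ∷ as) x G = trans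
    (permSum-cong as λ {τ} _ → ∑-* (suc (length τ)) x (λ p → G (insertAt p a τ)))
    (permSum-* as x (λ τ → insertSum a τ G))

  permSum-sum : ∀ W {n} (H : Fin n → List A → ℤ) → permSum W (λ τ → sum (λ i → H i τ)) ≡ sum (λ i → permSum W (H i))
  permSum-sum W {zero}  H = trans (permSum-* W 0ℤ (λ _ → 0ℤ)) (*-zeroˡ (permSum W (λ _ → 0ℤ)))
  permSum-sum W {suc n} H = trans (permSum-+ W (H Fin.zero) (λ τ → sum (λ i → H (Fin.suc i) τ)))
                                  (cong (λ s → permSum W (H Fin.zero) + s) (permSum-sum W (H ∘ Fin.suc)))

  permSum-nonneg : ∀ W {G} → (∀ {τ} → τ ↭ W → 0ℤ ≤ G τ) → 0ℤ ≤ permSum W G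
  permSum-nonneg W {G} G≥0 =
    ≤-trans (≤-reflexive (sym (trans (permSum-* W 0ℤ (λ _ → 0ℤ)) (*-zeroˡ (permSum W (λ _ → 0ℤ))))))
            (permSum-mono W G≥0)

  -- Every list has at least one order: keep one term at each insertion and bound the others by 0.
  permSum-≤-1 : ∀ W {G} → (∀ τ → G τ ≤ -1ℤ) → permSum W G ≤ -1ℤ
  permSum-≤-1 []       G≤-1 = G≤-1 []
  permSum-≤-1 (a ∷ as) {G} G≤-1 = permSum-≤-1 as λ τ →
    +-mono-≤ (G≤-1 (a ∷ τ)) (subst (sum {length τ} (λ p → G (insertAt (suc (toℕ p)) a τ)) ≤_) (sum-replicate-zero (length τ))
      (sum-mono {length τ} λ p → ≤-trans (G≤-1 (insertAt (suc (toℕ p)) a τ)) -≤+))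

  -- Both sides run over the same lists. They are split according to which of `a` and `b` go in
  -- front of `t`; if both go behind it, the induction hypothesis applies.
  insertSum-comm : ∀ a b τ G → insertSum a τ (λ σ → insertSum b σ G) ≡ insertSum b τ (λ σ → insertSum a σ G)
  insertSum-comm a b [] G = lem (G (b ∷ a ∷ [])) (G (a ∷ b ∷ []))
    where
    lem : ∀ x y → (x + (y + 0ℤ)) + 0ℤ ≡ (y + (x + 0ℤ)) + 0ℤ
    lem = solve-∀
  insertSum-comm a b (t ∷ τ) G = begin
    insertSum b (a ∷ t ∷ τ) G + ∑ (suc (length τ)) (λ p → insertSum b (t ∷ insertAt p a τ) G)
      ≡⟨ cong (λ s → insertSum b (a ∷ t ∷ τ) G + s) (∑-+ (suc (length τ)) (λ p → G (b ∷ t ∷ insertAt p a τ)) (λ p → insertSum b (insertAt p a τ) (G ∘ (t ∷_)))) ⟩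
    (G (b ∷ a ∷ t ∷ τ) + (G (a ∷ b ∷ t ∷ τ) + insertSum b τ (λ σ → G (a ∷ t ∷ σ))))
      + (insertSum a τ (λ σ → G (b ∷ t ∷ σ)) + insertSum a τ (λ σ → insertSum b σ (G ∘ (t ∷_))))
      ≡⟨ cong (λ s → (G (b ∷ a ∷ t ∷ τ) + (G (a ∷ b ∷ t ∷ τ) + insertSum b τ (λ σ → G (a ∷ t ∷ σ))))
                     + (insertSum a τ (λ σ → G (b ∷ t ∷ σ)) + s)) (insertSum-comm a b τ (G ∘ (t ∷_))) ⟩
    (G (b ∷ a ∷ t ∷ τ) + (G (a ∷ b ∷ t ∷ τ) + insertSum b τ (λ σ → G (a ∷ t ∷ σ))))
      + (insertSum a τ (λ σ → G (b ∷ t ∷ σ)) + insertSum b τ (λ σ → insertSum a σ (G ∘ (t ∷_))))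
      ≡⟨ lem (G (b ∷ a ∷ t ∷ τ)) (G (a ∷ b ∷ t ∷ τ)) (insertSum b τ (λ σ → G (a ∷ t ∷ σ))) (insertSum a τ (λ σ → G (b ∷ t ∷ σ))) (insertSum b τ (λ σ → insertSum a σ (G ∘ (t ∷_)))) ⟩
    (G (a ∷ b ∷ t ∷ τ) + (G (b ∷ a ∷ t ∷ τ) + insertSum a τ (λ σ → G (b ∷ t ∷ σ))))
      + (insertSum b τ (λ σ → G (a ∷ t ∷ σ)) + insertSum b τ (λ σ → insertSum a σ (G ∘ (t ∷_))))
      ≡⟨ cong (λ s → insertSum a (b ∷ t ∷ τ) G + s) (sym (∑-+ (suc (length τ)) (λ p → G (a ∷ t ∷ insertAt p b τ)) (λ p → insertSum a (insertAt p b τ) (G ∘ (t ∷_))))) ⟩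
    insertSum a (b ∷ t ∷ τ) G + ∑ (suc (length τ)) (λ p → insertSum a (t ∷ insertAt p b τ) G) ∎
    where
    open ≡-Reasoning
    lem : ∀ x y u v z → (x + (y + u)) + (v + z) ≡ (y + (x + v)) + (u + z)
    lem = solve-∀

  permSum-↭ : ∀ {V W} G → V ↭ W → permSum V G ≡ permSum W G
  permSum-↭ G _↭_.refl            = refl
  permSum-↭ G (prep a V↭W)        = permSum-↭ (λ τ → insertSum a τ G) V↭W
  permSum-↭ G (swap {xs = V} a b V↭W) = trans
    (permSum-cong V λ {τ} _ → insertSum-comm b a τ G)
    (permSum-↭ (λ τ → insertSum a τ (λ σ → insertSum b σ G)) V↭W)
  permSum-↭ G (_↭_.trans V↭X X↭W) = trans (permSum-↭ G V↭X) (permSum-↭ G X↭W)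

  permSum-positions : ∀ a W G → permSum (a ∷ W) G ≡ ∑ (suc (length W)) (λ p → permSum W (λ τ → G (insertAt p a τ)))
  permSum-positions a W G = trans
    (permSum-cong W λ {τ} τ↭W → cong (λ n → ∑ (suc n) (λ p → G (insertAt p a τ))) (↭-length τ↭W))
    (permSum-sum W {suc (length W)} (λ p τ → G (insertAt (toℕ p) a τ)))

  Ignores : A → (List A → ℤ) → Set
  Ignores w φ = ∀ i τ → φ (insertAt i w τ) ≡ φ τ

  insertSum-ignored-zero : ∀ {w φ} a τ → Ignores w φ →
    insertSum w τ (λ σ → φ (a ∷ σ)) ≡ + suc (length τ) * φ (a ∷ τ)
  insertSum-ignored-zero {w} {φ} a τ ignores = trans
    (∑-cong (suc (length τ)) λ {i} _ → ignores (suc i) (a ∷ τ))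
    (sum-const (suc (length τ)) (φ (a ∷ τ)))

  -- With `a` at position p + 1, the element `w` lands in front of it in p + 1 ways, and deleting
  -- `w` then moves `a` to position p. In the remaining `length τ - p` ways `w` lies behind `a`,
  -- whose position is unaffected.
  insertSum-ignored-suc : ∀ {w φ} a p τ → Ignores w φ →
    insertSum w τ (λ σ → φ (insertAt (suc p) a σ))
      ≡ + suc p * φ (insertAt p a τ) + (+ length τ - + p) * φ (insertAt (suc p) a τ)
  insertSum-ignored-suc {w} {φ} a p [] ignores = trans (+-identityʳ (φ (w ∷ insertAt p a [])))
    (trans (ignores 0 (insertAt p a []))
      -- Past the end of the list both insertions give the same list, so the identity survives a
      -- negative second coefficient.
      (subst (λ σ → φ σ ≡ + suc p * φ σ + (0ℤ - + p) * φ (a ∷ [])) (sym (single p)) (lem (+ p) (φ (a ∷ [])))))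
    where
    single : ∀ p → insertAt p a [] ≡ a ∷ []
    single zero    = refl
    single (suc p) = refl
    lem : ∀ p x → x ≡ (1ℤ + p) * x + (0ℤ - p) * x
    lem = solve-∀
  insertSum-ignored-suc {w} {φ} a zero (t ∷ τ) ignores = trans
    (cong₂ _+_ (ignores 0 (a ∷ t ∷ τ)) (insertSum-ignored-zero a τ (λ i σ → ignores (suc i) (t ∷ σ))))
    (lem (φ (a ∷ t ∷ τ)) (φ (t ∷ a ∷ τ)) (+ suc (length τ)))
    where
    lem : ∀ x y n → x + n * y ≡ 1ℤ * x + (n - 0ℤ) * y
    lem = solve-∀
  insertSum-ignored-suc {w} {φ} a (suc p) (t ∷ τ) ignores = trans
    (cong₂ _+_ (ignores 0 (insertAt (suc p) a (t ∷ τ))) (insertSum-ignored-suc a p τ (λ i σ → ignores (suc i) (t ∷ σ))))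
    (lem (φ (t ∷ insertAt p a τ)) (φ (t ∷ insertAt (suc p) a τ)) (+ p) (+ length τ))
    where
    lem : ∀ x y p n → x + ((1ℤ + p) * x + (n - p) * y) ≡ (1ℤ + (1ℤ + p)) * x + ((1ℤ + n) - (1ℤ + p)) * y
    lem = solve-∀

-- Degree in the position of one element

DegreeAtMost-interpolate : ∀ u F → DegreeAtMost u u F
DegreeAtMost-interpolate zero    F = newton (λ _ → F 0) λ { z≤n → lem (F 0) }
  where
  lem : ∀ x → x ≡ x * 1ℤ + 0ℤ
  lem = solve-∀
DegreeAtMost-interpolate (suc u) F with DegreeAtMost-interpolate u F
... | newton c F≡ = newton c′ agree
  where
  P : ℕ → ℤ
  P p = ∑ (suc u) (λ j → c j * + (p C j))
  -- The new top coefficient is the interpolation error at u + 1. Its basis function is 0 at all p ≤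
  -- u and 1 at u + 1, so the earlier values are kept.
  c′ : ℕ → ℤ
  c′ j with j ℕ.≟ suc u
  ... | yes _ = F (suc u) - P (suc u)
  ... | no  _ = c j
  c′-< : ∀ {j} → j ℕ.< suc u → c′ j ≡ c j
  c′-< {j} j≤u with j ℕ.≟ suc u
  ... | yes refl = ⊥-elim (ℕₚ.<-irrefl refl j≤u)
  ... | no  _    = refl
  c′-top : c′ (suc u) ≡ F (suc u) - P (suc u)
  c′-top with suc u ℕ.≟ suc u
  ... | yes _ = refl
  ... | no ¬p = ⊥-elim (¬p refl)
  expand : ∀ p → ∑ (suc (suc u)) (λ j → c′ j * + (p C j)) ≡ P p + (F (suc u) - P (suc u)) * + (p C suc u)
  expand p = trans (∑-last (suc u) (λ j → c′ j * + (p C j)))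
    (cong₂ _+_ (∑-cong (suc u) λ {j} j≤u → cong (_* + (p C j)) (c′-< j≤u)) (cong (_* + (p C suc u)) c′-top))
  lem₁ : ∀ x y → x + y * 0ℤ ≡ x
  lem₁ = solve-∀
  lem₂ : ∀ x y → y ≡ x + (y - x) * 1ℤ
  lem₂ = solve-∀
  agree : ∀ {p} → p ℕ.≤ suc u → F p ≡ ∑ (suc (suc u)) (λ j → c′ j * + (p C j))
  agree {p} p≤1+u with ℕₚ.m≤n⇒m<n∨m≡n p≤1+u
  ... | inj₁ (s≤s p≤u) = trans (F≡ p≤u) (sym (trans (expand p)
          (trans (cong (λ b → P p + (F (suc u) - P (suc u)) * + b) (k>n⇒nCk≡0 (s≤s p≤u))) (lem₁ (P p) (F (suc u) - P (suc u))))))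
  ... | inj₂ refl = sym (trans (expand (suc u))
          (trans (cong (λ b → P (suc u) + (F (suc u) - P (suc u)) * + b) (nCn≡1 (suc u))) (sym (lem₂ (P (suc u)) (F (suc u))))))

DegreeAtMost-≤ : ∀ {u m n F} → m ℕ.≤ n → DegreeAtMost u n F → DegreeAtMost u m F
DegreeAtMost-≤ m≤n (newton c F≡) = newton c λ p≤m → F≡ (ℕₚ.≤-trans p≤m m≤n)

DegreeAtMost-cong : ∀ {u n F G} → (∀ {p} → p ℕ.≤ n → F p ≡ G p) → DegreeAtMost u n F → DegreeAtMost u n G
DegreeAtMost-cong F≡G (newton c F≡) = newton c λ p≤n → trans (sym (F≡G p≤n)) (F≡ p≤n)

DegreeAtMost-+ : ∀ {u n F G} → DegreeAtMost u n F → DegreeAtMost u n G → DegreeAtMost u n (λ p → F p + G p)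
DegreeAtMost-+ {u} (newton c F≡) (newton d G≡) = newton (λ j → c j + d j) λ {p} p≤n → trans (cong₂ _+_ (F≡ p≤n) (G≡ p≤n))
  (trans (sym (∑-+ (suc u) (λ j → c j * + (p C j)) (λ j → d j * + (p C j))))
    (∑-cong (suc u) λ {j} _ → sym (*-distribʳ-+ (+ (p C j)) (c j) (d j))))

DegreeAtMost-* : ∀ x {u n F} → DegreeAtMost u n F → DegreeAtMost u n (λ p → x * F p)
DegreeAtMost-* x {u} (newton c F≡) = newton (λ j → x * c j) λ {p} p≤n → trans (cong (x *_) (F≡ p≤n))
  (trans (sym (∑-* (suc u) x (λ j → c j * + (p C j)))) (∑-cong (suc u) λ {j} _ → sym (*-assoc x (c j) (+ (p C j)))))

DegreeAtMost-sum : ∀ {u n m} (F : Fin m → ℕ → ℤ) → (∀ i → DegreeAtMost u n (F i)) → DegreeAtMost u n (λ p → sum (λ i → F i p))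
DegreeAtMost-sum {u} {m = zero}  F h = newton (λ _ → 0ℤ) λ {p} _ → sym (sum-0 {suc u} λ j → *-zeroˡ (+ (p C toℕ j)))
DegreeAtMost-sum {m = suc m} F h = DegreeAtMost-+ (h Fin.zero) (DegreeAtMost-sum (F ∘ Fin.suc) (h ∘ Fin.suc))

-- The binomial p C j is an eigenvector, with eigenvalue m + 1 - j, of the recurrence that
-- inserting an ignored element induces.
DegreeAtMost-insert : ∀ {u m F F′} → DegreeAtMost u m F → F′ 0 ≡ + suc m * F 0 →
  (∀ p → F′ (suc p) ≡ + suc p * F p + (+ m - + p) * F (suc p)) → DegreeAtMost u (suc m) F′
DegreeAtMost-insert {u} {m} {F} {F′} (newton c F≡) F′0 F′suc = newton c′ agree
  where
  open ≡-Reasoning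
  c′ : ℕ → ℤ
  c′ j = c j * (+ suc m - + j)
  P : ℕ → ℤ
  P p = ∑ (suc u) (λ j → c j * + (p C j))
  lem₀ : ∀ x c m → m * (c * x) ≡ c * (m - 0ℤ) * x
  lem₀ = solve-∀
  lem₀′ : ∀ m c e → m * (c * 0ℤ) ≡ c * e * 0ℤ
  lem₀′ = solve-∀
  zero-term : ∀ j → + suc m * (c j * + (0 C j)) ≡ c′ j * + (0 C j)
  zero-term zero    = lem₀ 1ℤ (c 0) (+ suc m)
  zero-term (suc j) = lem₀′ (+ suc m) (c (suc j)) (+ suc m - + suc j)
  lem₁ : ∀ s m p c x y → s * (c * x) + (m - p) * (c * y) ≡ c * (s * x + (m - p) * y)
  lem₁ = solve-∀
  lem₂ : ∀ m p j c y → c * (((1ℤ + p) - j) * y + (m - p) * y) ≡ c * ((1ℤ + m) - j) * y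
  lem₂ = solve-∀
  suc-term : ∀ p j → + suc p * (c j * + (p C j)) + (+ m - + p) * (c j * + (suc p C j)) ≡ c′ j * + (suc p C j)
  suc-term p j = begin
    + suc p * (c j * + (p C j)) + (+ m - + p) * (c j * + (suc p C j))
      ≡⟨ lem₁ (+ suc p) (+ m) (+ p) (c j) (+ (p C j)) (+ (suc p C j)) ⟩
    c j * (+ suc p * + (p C j) + (+ m - + p) * + (suc p C j))
      ≡⟨ cong (λ s → c j * (s + (+ m - + p) * + (suc p C j))) (sym ([n+1-k]*[n+1]Ck p j)) ⟩
    c j * ((+ suc p - + j) * + (suc p C j) + (+ m - + p) * + (suc p C j))
      ≡⟨ lem₂ (+ m) (+ p) (+ j) (c j) (+ (suc p C j)) ⟩
    c′ j * + (suc p C j) ∎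
  -- At `p = m` the value `F (suc m)` lies outside the range of the expansion, but its factor m - p
  -- is zero.
  last-coefficient : ∀ {p} → p ℕ.≤ m → (+ m - + p) * F (suc p) ≡ (+ m - + p) * P (suc p)
  last-coefficient {p} p≤m with ℕₚ.m≤n⇒m<n∨m≡n p≤m
  ... | inj₁ p<m  = cong (λ s → (+ m - + p) * s) (F≡ p<m)
  ... | inj₂ refl = trans (cong (_* F (suc p)) (+-inverseʳ (+ p)))
                      (trans (*-zeroˡ (F (suc p))) (sym (trans (cong (_* P (suc p)) (+-inverseʳ (+ p))) (*-zeroˡ (P (suc p))))))
  agree : ∀ {p} → p ℕ.≤ suc m → F′ p ≡ ∑ (suc u) (λ j → c′ j * + (p C j))
  agree {zero} _ = begin
    F′ 0                                        ≡⟨ F′0 ⟩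
    + suc m * F 0                               ≡⟨ cong (λ s → + suc m * s) (F≡ z≤n) ⟩
    + suc m * P 0                               ≡⟨ sym (∑-* (suc u) (+ suc m) (λ j → c j * + (0 C j))) ⟩
    ∑ (suc u) (λ j → + suc m * (c j * + (0 C j))) ≡⟨ ∑-cong (suc u) (λ {j} _ → zero-term j) ⟩
    ∑ (suc u) (λ j → c′ j * + (0 C j))          ∎
  agree {suc p} (s≤s p≤m) = begin
    F′ (suc p)
      ≡⟨ F′suc p ⟩
    + suc p * F p + (+ m - + p) * F (suc p)
      ≡⟨ cong₂ (λ s s′ → + suc p * s + s′) (F≡ p≤m) (last-coefficient p≤m) ⟩
    + suc p * P p + (+ m - + p) * P (suc p)
      ≡⟨ cong₂ _+_ (sym (∑-* (suc u) (+ suc p) (λ j → c j * + (p C j)))) (sym (∑-* (suc u) (+ m - + p) (λ j → c j * + (suc p C j)))) ⟩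
    ∑ (suc u) (λ j → + suc p * (c j * + (p C j))) + ∑ (suc u) (λ j → (+ m - + p) * (c j * + (suc p C j)))
      ≡⟨ sym (∑-+ (suc u) (λ j → + suc p * (c j * + (p C j))) (λ j → (+ m - + p) * (c j * + (suc p C j)))) ⟩
    ∑ (suc u) (λ j → + suc p * (c j * + (p C j)) + (+ m - + p) * (c j * + (suc p C j)))
      ≡⟨ ∑-cong (suc u) (λ {j} _ → suc-term p j) ⟩
    ∑ (suc u) (λ j → c′ j * + (suc p C j)) ∎

module _ {A : Set} where

  private
    position : A → (List A → ℤ) → List A → ℕ → ℤ
    position a φ W p = permSum W (λ τ → φ (insertAt p a τ))

  -- The at most `u` elements of `U` come first, and any function on 0, ..., u has degree at most
  -- `u`. The ignored elements are inserted afterwards, each preserving the degree.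
  DegreeAtMost-permSum-++ : ∀ {φ : List A → ℤ} {u} a ws U → (∀ {w} → w ∈ ws → Ignores w φ) → length U ℕ.≤ u →
    DegreeAtMost u (length (ws ++ U)) (position a φ (ws ++ U))
  DegreeAtMost-permSum-++ {φ} {u} a []       U ignores ∣U∣≤u =
    DegreeAtMost-≤ ∣U∣≤u (DegreeAtMost-interpolate u (position a φ U))
  DegreeAtMost-permSum-++ {φ} {u} a (w ∷ ws) U ignores ∣U∣≤u =
    DegreeAtMost-insert (DegreeAtMost-permSum-++ {φ} {u} a ws U (ignores ∘ there) ∣U∣≤u)
      (trans (permSum-cong V λ {τ} τ↭V → trans (insertSum-ignored-zero a τ ign) (cong (λ n → + suc n * φ (a ∷ τ)) (↭-length τ↭V)))
             (permSum-* V (+ suc (length V)) (λ τ → φ (a ∷ τ))))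
      (λ p → trans (permSum-cong V λ {τ} τ↭V → trans (insertSum-ignored-suc a p τ ign)
                     (cong (λ n → + suc p * φ (insertAt p a τ) + (+ n - + p) * φ (insertAt (suc p) a τ)) (↭-length τ↭V)))
             (trans (permSum-+ V (λ τ → + suc p * φ (insertAt p a τ)) (λ τ → (+ length V - + p) * φ (insertAt (suc p) a τ)))
               (cong₂ _+_ (permSum-* V (+ suc p) (λ τ → φ (insertAt p a τ))) (permSum-* V (+ length V - + p) (λ τ → φ (insertAt (suc p) a τ))))))
    where
    V : List A
    V = ws ++ U
    ign : Ignores w φ
    ign = ignores (here refl)

  DegreeAtMost-permSum-↭ : ∀ {φ : List A → ℤ} {u V W} a → V ↭ W →
    DegreeAtMost u (length V) (position a φ V) → DegreeAtMost u (length W) (position a φ W)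
  DegreeAtMost-permSum-↭ {φ} {u} {V} {W} a V↭W deg =
    DegreeAtMost-cong (λ {p} _ → permSum-↭ (λ τ → φ (insertAt p a τ)) V↭W)
      (subst (λ n → DegreeAtMost u n (position a φ V)) (↭-length V↭W) deg)

-- Linear orders as inputs

-- Orders are listed from the least element up. Testing for `c` first makes the relation
-- irreflexive.
before : ∀ {N} → Fin N → Fin N → List (Fin N) → Bool
before b c []      = false
before b c (t ∷ τ) = if does (t ≟ c) then false else if does (t ≟ b) then true else before b c τ

orderInput : ∀ {N} → List (Fin N) → Fin N × Fin N → Bool
orderInput τ (b , c) = before b c τ

before-irrefl : ∀ {N} (a : Fin N) τ → before a a τ ≡ false
before-irrefl a []      = refl
before-irrefl a (t ∷ τ) with t ≟ a
... | yes _ = refl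
... | no  _ = before-irrefl a τ

before-head : ∀ {N} (a t : Fin N) τ → before a t (t ∷ τ) ≡ false
before-head a t τ with t ≟ t
... | yes _  = refl
... | no t≢t = ⊥-elim (t≢t refl)

before-trans : ∀ {N} {a b c : Fin N} τ → before a b τ ≡ true → before b c τ ≡ true → before a c τ ≡ true
before-trans {a = a} {b} {c} (t ∷ τ) ab bc with t ≟ c | t ≟ b | t ≟ a
before-trans (t ∷ τ) ab () | yes _ | _     | _
before-trans (t ∷ τ) () bc | no _  | yes _ | _
before-trans (t ∷ τ) ab bc | no _  | no _  | yes _ = refl
before-trans (t ∷ τ) ab bc | no _  | no _  | no _  = before-trans τ ab bc

before-total : ∀ {N} {a b : Fin N} {τ} → a ∈ τ → a ≢ b → before a b τ ≡ false → before b a τ ≢ false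
before-total {a = a} {b} {t ∷ τ} a∈τ a≢b ab ba with t ≟ b | t ≟ a
before-total {τ = t ∷ τ} a∈τ         a≢b ab ba | yes refl | yes refl = a≢b refl
before-total {τ = t ∷ τ} a∈τ         a≢b ab () | yes refl | no _
before-total {τ = t ∷ τ} a∈τ         a≢b () ba | no _     | yes refl
before-total {τ = t ∷ τ} (here refl) a≢b ab ba | no _     | no t≢a   = t≢a refl
before-total {τ = t ∷ τ} (there a∈τ) a≢b ab ba | no _     | no _     = before-total a∈τ a≢b ab ba

before-insertAt : ∀ {N} {b c w : Fin N} → w ≢ b → w ≢ c → ∀ i τ → before b c (insertAt i w τ) ≡ before b c τ
before-insertAt {b = b} {c} {w} w≢b w≢c zero τ with w ≟ c | w ≟ b
... | yes w≡c | _       = ⊥-elim (w≢c w≡c)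
... | no _    | yes w≡b = ⊥-elim (w≢b w≡b)
... | no _    | no _    = refl
before-insertAt w≢b w≢c (suc i) []      = before-insertAt w≢b w≢c zero []
before-insertAt {b = b} {c} w≢b w≢c (suc i) (t ∷ τ) with t ≟ c | t ≟ b
... | yes _ | _     = refl
... | no _  | yes _ = refl
... | no _  | no _  = before-insertAt w≢b w≢c i τ

allFin-↭-∷ : ∀ {N} (a : Fin N) → ∃ λ W → a ∷ W ↭ allFin N
allFin-↭-∷ a with ∈-∃++ (∈-allFin a)
... | ys , zs , eq = ys ++ zs , ↭-trans (↭-sym (shift a ys zs)) (↭-reflexive (sym eq))

true≢false : true ≢ false
true≢false ()

-- A genuine linear order contains no violation, so only a minimal element can be a solution, and
-- nothing precedes the head of the list.
order-solution : ∀ {n} {τ : List (Fin (2 ℕ.^ n))} {o} → τ ↭ allFin (2 ℕ.^ n) → LOP n (orderInput τ) o →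
  ∃₂ λ a σ → o ≡ minimal a × τ ≡ a ∷ σ
order-solution {τ = []}    {minimal a} τ↭ min with ∈-resp-↭ (↭-sym τ↭) (∈-allFin a)
... | ()
order-solution {τ = t ∷ σ} {minimal a} τ↭ min =
  a , σ , refl , cong (_∷ σ) (decidable-stable (t ≟ a) λ t≢a → true≢false (trans (sym (min t t≢a)) (before-head a t σ)))
order-solution {τ = τ} {reflexive a} τ↭ aa = ⊥-elim (true≢false (trans (sym aa) (before-irrefl a τ)))
order-solution {o = incomp a b} τ↭ (a≢b , ab , ba) =
  ⊥-elim (before-total (∈-resp-↭ (↭-sym τ↭) (∈-allFin a)) a≢b ab ba)
order-solution {τ = τ} {transFail a b c} τ↭ (_ , ab , bc , ac) =
  ⊥-elim (true≢false (trans (sym (before-trans τ ab bc)) ac))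

-- Decision trees reading a random order

agree : Bool → Bool → ℤ
agree true  true  = 1ℤ
agree false false = 1ℤ
agree _     _     = 0ℤ

indicator : ∀ {V : Set} → List (V × Bool) → (V → Bool) → ℤ
indicator []            x = 1ℤ
indicator ((v , b) ∷ π) x = agree (x v) b * indicator π x

touched : ∀ {N} → List ((Fin N × Fin N) × Bool) → List (Fin N)
touched []                  = []
touched (((b , c) , _) ∷ π) = b ∷ c ∷ touched π

length-touched : ∀ {N} (π : List ((Fin N × Fin N) × Bool)) → length (touched π) ≡ length π ℕ.+ length π
length-touched []      = refl
length-touched (_ ∷ π) = cong suc (trans (cong suc (length-touched π)) (sym (ℕₚ.+-suc (length π) (length π))))

indicator-ignores : ∀ {N} (π : List ((Fin N × Fin N) × Bool)) {w} → w ∉ touched π → Ignores w (indicator π ∘ orderInput)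
indicator-ignores []                  w∉ i τ = refl
indicator-ignores (((b , c) , v) ∷ π) w∉ i τ =
  cong₂ (λ x y → agree x v * y) (before-insertAt (w∉ ∘ here) (w∉ ∘ there ∘ here) i τ)
                                (indicator-ignores π (w∉ ∘ there ∘ there) i τ)

Unique-↭ : ∀ {A : Set} {xs ys : List A} → xs ↭ ys → Unique xs → Unique ys
Unique-↭ {A} xs↭ys = Permutationₛ.Unique-resp-↭ (setoid A) (↭⇒↭ₛ xs↭ys)

-- Puts the elements outside `T` in front, where `permSum` inserts them last. Since `W` has no
-- repetitions, each entry of `T` moves at most one element to `U`.
separate : ∀ {N} (T W : List (Fin N)) → Unique W →
  ∃₂ λ ws U → W ↭ ws ++ U × length U ℕ.≤ length T × Unique ws × (∀ {w} → w ∈ ws → w ∉ T)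
separate []      W unique = W , [] , ↭-reflexive (sym (++-identityʳ W)) , z≤n , unique , λ _ ()
separate {N} (t ∷ T) W unique with separate T W unique
... | ws , U , W↭ , ∣U∣≤ , unique-ws , ws∉T with _∈?_ _≟_ t ws
...   | no t∉ws = ws , U , W↭ , ℕₚ.m≤n⇒m≤1+n ∣U∣≤ , unique-ws ,
                  λ { w∈ws (here refl) → t∉ws w∈ws ; w∈ws (there w∈T) → ws∉T w∈ws w∈T }
...   | yes t∈ws with ∈-∃++ t∈ws
...     | ys , zs , refl = ys ++ zs , t ∷ U , ↭-trans W↭ move , s≤s ∣U∣≤ , tail unique-tws ,
                           λ { w∈ (here refl) → Unique[x∷xs]⇒x∉xs unique-tws w∈
                             ; w∈ (there w∈T) → ws∉T (∈-resp-↭ (↭-sym (shift t ys zs)) (there w∈)) w∈T }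
  where
  move : (ys ++ t ∷ zs) ++ U ↭ (ys ++ zs) ++ t ∷ U
  move = ↭-trans (++⁺ʳ U (shift t ys zs)) (↭-sym (shift t (ys ++ zs) U))
  unique-tws : Unique (t ∷ ys ++ zs)
  unique-tws = Unique-↭ (shift t ys zs) unique-ws

-- Descending the tree extends the path `π`: at a node the indicator splits into the two extended
-- ones. At a leaf at most `D` comparisons have been read, each touching two elements, whence the
-- degree `D + D`.
DegreeAtMost-tree : ∀ {N D} a {W : List (Fin N)} → Unique W → (T : DT (Fin N × Fin N) ℤ) →
  ∀ π → length π ℕ.+ depth T ℕ.≤ D → DegreeAtMost (D ℕ.+ D) (length W)
    (λ p → permSum W (λ τ → indicator π (orderInput (insertAt p a τ)) * eval T (orderInput (insertAt p a τ))))
DegreeAtMost-tree {D = D} a {W} unique (leaf z) π ∣π∣≤D with separate (touched π) W unique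
... | ws , U , W↭ , ∣U∣≤ , _ , ws∉ = DegreeAtMost-permSum-↭ {φ = φ} a (↭-sym W↭)
  (DegreeAtMost-permSum-++ {φ = φ} a ws U (λ w∈ i τ → cong (_* z) (indicator-ignores π (ws∉ w∈) i τ))
    (ℕₚ.≤-trans ∣U∣≤ (subst (ℕ._≤ D ℕ.+ D) (sym (length-touched π)) (ℕₚ.+-mono-≤ ∣π∣≤D′ ∣π∣≤D′))))
  where
  φ = λ τ → indicator π (orderInput τ) * z
  ∣π∣≤D′ : length π ℕ.≤ D
  ∣π∣≤D′ = ℕₚ.≤-trans (ℕₚ.m≤m+n (length π) 0) ∣π∣≤D
DegreeAtMost-tree {D = D} a {W} unique (node v l r) π ∣π∣+depth≤D =
  DegreeAtMost-cong (λ {p} _ → sym (trans (permSum-cong W λ {τ} _ → branch (orderInput (insertAt p a τ)))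
      (permSum-+ W (φ ((v , true) ∷ π) r ∘ insertAt p a) (φ ((v , false) ∷ π) l ∘ insertAt p a))))
    (DegreeAtMost-+ (DegreeAtMost-tree a unique r ((v , true) ∷ π) (bound (ℕₚ.m≤n⊔m (depth l) (depth r))))
                    (DegreeAtMost-tree a unique l ((v , false) ∷ π) (bound (ℕₚ.m≤m⊔n (depth l) (depth r)))))
  where
  φ : List (_ × Bool) → DT _ ℤ → List _ → ℤ
  φ π T τ = indicator π (orderInput τ) * eval T (orderInput τ)
  bound : ∀ {e} → e ℕ.≤ depth l ℕ.⊔ depth r → suc (length π ℕ.+ e) ℕ.≤ D
  bound e≤ = ℕₚ.≤-trans (s≤s (ℕₚ.+-monoʳ-≤ (length π) e≤))
               (ℕₚ.≤-trans (ℕₚ.≤-reflexive (sym (ℕₚ.+-suc (length π) _))) ∣π∣+depth≤D)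
  lem₁ : ∀ i r l → i * r ≡ 1ℤ * i * r + 0ℤ * i * l
  lem₁ = solve-∀
  lem₂ : ∀ i r l → i * l ≡ 0ℤ * i * r + 1ℤ * i * l
  lem₂ = solve-∀
  branch : ∀ x → indicator π x * eval (node v l r) x ≡
                 indicator ((v , true) ∷ π) x * eval r x + indicator ((v , false) ∷ π) x * eval l x
  branch x with x v
  ... | true  = lem₁ (indicator π x) (eval r x) (eval l x)
  ... | false = lem₂ (indicator π x) (eval r x) (eval l x)

-- Composition of decision trees

infixl 1 _>>=_
_>>=_ : ∀ {V A B : Set} → DT V A → (A → DT V B) → DT V B
leaf a     >>= k = k a
node v l r >>= k = node v (l >>= k) (r >>= k)

eval->>= : ∀ {V A B : Set} (T : DT V A) (k : A → DT V B) x → eval (T >>= k) x ≡ eval (k (eval T x)) x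
eval->>= (leaf a)     k x = refl
eval->>= (node v l r) k x with x v
... | true  = eval->>= r k x
... | false = eval->>= l k x

depth->>= : ∀ {V A B : Set} {m n} (T : DT V A) (k : A → DT V B) → depth T ℕ.≤ m → (∀ a → depth (k a) ℕ.≤ n) →
  depth (T >>= k) ℕ.≤ m ℕ.+ n
depth->>= {m = m} (leaf a) k T≤m k≤n = ℕₚ.≤-trans (k≤n a) (ℕₚ.m≤n+m _ m)
depth->>= (node v l r) k (s≤s T≤m) k≤n = s≤s (ℕₚ.⊔-lub
  (depth->>= l k (ℕₚ.≤-trans (ℕₚ.m≤m⊔n (depth l) (depth r)) T≤m) k≤n)
  (depth->>= r k (ℕₚ.≤-trans (ℕₚ.m≤n⊔m (depth l) (depth r)) T≤m) k≤n))

sequence : ∀ {V : Set} {k} → (Fin k → DT V Bool) → DT V (Fin k → Bool)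
sequence {k = zero}  T = leaf λ ()
sequence {k = suc k} T = T Fin.zero >>= λ b → sequence (T ∘ Fin.suc) >>= λ bs → leaf (b ∷ᶠ bs)

eval-sequence : ∀ {V : Set} {k} (T : Fin k → DT V Bool) x → eval (sequence T) x ≗ λ j → eval (T j) x
eval-sequence {k = suc k} T x j = trans (cong (λ h → h j)
  (trans (eval->>= (T Fin.zero) _ x) (eval->>= (sequence (T ∘ Fin.suc)) (λ bs → leaf (eval (T Fin.zero) x ∷ᶠ bs)) x))) (at j)
  where
  at : ∀ j → (eval (T Fin.zero) x ∷ᶠ eval (sequence (T ∘ Fin.suc)) x) j ≡ eval (T j) x
  at Fin.zero    = refl
  at (Fin.suc j) = eval-sequence (T ∘ Fin.suc) x j

depth-sequence : ∀ {V : Set} {k d} (T : Fin k → DT V Bool) → (∀ j → depth (T j) ℕ.≤ d) → depth (sequence T) ℕ.≤ k ℕ.* d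
depth-sequence {k = zero}      T T≤d = z≤n
depth-sequence {k = suc k} {d} T T≤d = depth->>= (T Fin.zero) _ (T≤d Fin.zero) λ b →
  subst (depth (sequence (T ∘ Fin.suc) >>= λ bs → leaf (b ∷ᶠ bs)) ℕ.≤_) (ℕₚ.+-identityʳ (k ℕ.* d))
    (depth->>= (sequence (T ∘ Fin.suc)) (λ bs → leaf (b ∷ᶠ bs)) (depth-sequence (T ∘ Fin.suc) (T≤d ∘ Fin.suc)) (λ _ → z≤n))

decode-cong : ∀ {k} {b c : Fin k → Bool} → b ≗ c → decode b ≡ decode c
decode-cong {zero}  b≗c = refl
decode-cong {suc k} b≗c = cong₂ (λ x y → (if x then 1 else 0) ℕ.+ 2 ℕ.* y) (b≗c Fin.zero) (decode-cong (b≗c ∘ Fin.suc))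

-- Counting preimages under a formulation

⟦_⟧ : {P : Set} → Dec P → ℤ
⟦ P? ⟧ = if does P? then 1ℤ else 0ℤ

⟦⟧-nonneg : {P : Set} (P? : Dec P) → 0ℤ ≤ ⟦ P? ⟧
⟦⟧-nonneg (yes _) = +≤+ z≤n
⟦⟧-nonneg (no _)  = +≤+ z≤n

term≤sum : ∀ {n} {f : Fin n → ℤ} → (∀ i → 0ℤ ≤ f i) → ∀ i → f i ≤ sum f
term≤sum {suc n} {f} f≥0 i = ≤-trans (≤-reflexive (sym (+-identityʳ (f i))))
  (≤-trans (+-monoʳ-≤ (f i) (sum-nonneg {n} λ j → f≥0 (punchIn i j))) (≤-reflexive (sym (sum-remove {n} {i} f))))

-- Only an inequality: k + 1 bits can also encode numbers beyond 2^k, which match no candidate `y`.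
sum-⟦≡⟧-≤1 : ∀ m v → sum {m} (λ y → ⟦ v ℕ.≟ toℕ y ⟧) ≤ 1ℤ
sum-⟦≡⟧-≤1 zero    v       = +≤+ z≤n
sum-⟦≡⟧-≤1 (suc m) zero    = ≤-reflexive (cong (λ s → 1ℤ + s) (sum-0 {m} λ _ → refl))
sum-⟦≡⟧-≤1 (suc m) (suc v) = ≤-trans (≤-reflexive (+-identityˡ (sum {m} (λ y → ⟦ v ℕ.≟ toℕ y ⟧)))) (sum-⟦≡⟧-≤1 m v)

sum-⟦≡⟧ : ∀ {m} (a : Fin m) → sum (λ b → ⟦ b ≟ a ⟧) ≡ 1ℤ
sum-⟦≡⟧ {suc m} Fin.zero    = cong (λ s → 1ℤ + s) (sum-0 {m} λ _ → refl)
sum-⟦≡⟧ {suc m} (Fin.suc a) = trans (+-identityˡ (sum (λ b → ⟦ Fin.suc b ≟ Fin.suc a ⟧))) (sum-⟦≡⟧ a)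

isMinimal : ∀ {N} → Fin N → LOPOut N → ℤ
isMinimal a (minimal b)       = ⟦ a ≟ b ⟧
isMinimal a (reflexive _)     = 0ℤ
isMinimal a (incomp _ _)      = 0ℤ
isMinimal a (transFail _ _ _) = 0ℤ

module _ {n k d : ℕ} (Φ : Formulation (LOP n) (sAvoid k) d) where
  open Formulation Φ

  private
    N D u r : ℕ
    N = 2 ℕ.^ n
    -- One tree for the output at `y`, then one for each of the k + 1 bits of a single value of the
    -- circuit.
    D = d ℕ.+ suc k ℕ.* d
    u = D ℕ.+ D
    r = suc u ℕ.+ suc u

    Input : Set
    Input = Fin N × Fin N → Bool

  value : Input → Fin (2 ℕ.^ k) → ℕ
  value x i = decode (λ j → eval (f (i , j)) x)

  preimages : Fin (2 ℕ.^ k ℕ.+ 1) → Input → ℤ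
  preimages y x = sum (λ i → ⟦ value x i ℕ.≟ toℕ y ⟧)

  excess : Fin (2 ℕ.^ k ℕ.+ 1) → Input → ℤ
  excess y x = preimages y x + -1ℤ

  -- Double counting: each of the 2^k indices is a preimage of at most one candidate, while 1 is
  -- subtracted for each of the 2^k + 1 candidates.
  sum-excess-≤-1 : ∀ x → sum (λ y → excess y x) ≤ -1ℤ
  sum-excess-≤-1 x = begin
    sum {M ℕ.+ 1} (λ y → excess y x)
      ≡⟨ ∑-distrib-+ {M ℕ.+ 1} (λ y → preimages y x) (λ _ → -1ℤ) ⟩
    sum {M ℕ.+ 1} (λ y → preimages y x) + sum {M ℕ.+ 1} (λ _ → -1ℤ)
      ≡⟨ cong₂ _+_ (∑-comm {M ℕ.+ 1} {M} (λ y i → ⟦ value x i ℕ.≟ toℕ y ⟧)) (sum-const (M ℕ.+ 1) -1ℤ) ⟩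
    sum {M} (λ i → sum {M ℕ.+ 1} (λ y → ⟦ value x i ℕ.≟ toℕ y ⟧)) + + (M ℕ.+ 1) * -1ℤ
      ≤⟨ +-monoˡ-≤ (+ (M ℕ.+ 1) * -1ℤ) (sum-mono {M} λ i → sum-⟦≡⟧-≤1 (M ℕ.+ 1) (value x i)) ⟩
    sum {M} (λ _ → 1ℤ) + + (M ℕ.+ 1) * -1ℤ
      ≡⟨ cong₂ (λ s t → s + t * -1ℤ) (sum-const M 1ℤ) (pos-+ M 1) ⟩
    + M * 1ℤ + (+ M + 1ℤ) * -1ℤ
      ≡⟨ lem (+ M) ⟩
    -1ℤ ∎
    where
    open ≤-Reasoning
    M = 2 ℕ.^ k
    lem : ∀ m → m * 1ℤ + (m + 1ℤ) * -1ℤ ≡ -1ℤ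
    lem = solve-∀

  excess-nonneg-or-solved : ∀ y x → 0ℤ ≤ excess y x ⊎ LOP n x (eval (g y) x)
  excess-nonneg-or-solved y x with any? (λ i → value x i ℕ.≟ toℕ y)
  ... | no ∄i         = inj₂ (correct x y (λ i eq → ∄i (i , eq)))
  ... | yes (i , eq) = inj₁ (+-monoˡ-≤ -1ℤ (≤-trans (≤-reflexive (sym (hit (value x i ℕ.≟ toℕ y))))
      (term≤sum (λ j → ⟦⟧-nonneg (value x j ℕ.≟ toℕ y)) i)))
    where
    hit : (P? : Dec (value x i ≡ toℕ y)) → ⟦ P? ⟧ ≡ 1ℤ
    hit (yes _) = refl
    hit (no ¬p) = ⊥-elim (¬p eq)

  minimalExcess : Fin (2 ℕ.^ k ℕ.+ 1) → Fin N → Input → ℤ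
  minimalExcess y a x = isMinimal a (eval (g y) x) * excess y x

  -- An output "minimal b" contributes exactly the excess. Any other output is wrong on a linear
  -- order, so `y` has a preimage, and the left side 0 is at most the excess.
  sum-minimalExcess : ∀ y {τ} → τ ↭ allFin N →
    sum (λ a → minimalExcess y a (orderInput τ)) ≤ excess y (orderInput τ)
  sum-minimalExcess y {τ} τ↭ = ≤-trans (≤-reflexive (sym (*-distribʳ-sum (excess y x) (λ a → isMinimal a (eval (g y) x)))))
    (select (eval (g y) x) refl)
    where
    x = orderInput τ
    other : ∀ o → eval (g y) x ≡ o → (∀ a → isMinimal a o ≡ 0ℤ) → sum (λ a → isMinimal a o) * excess y x ≤ excess y x
    other o eq isMinimal≡0 = ≤-trans
      (≤-reflexive (trans (cong (_* excess y x) (sum-0 isMinimal≡0)) (*-zeroˡ (excess y x))))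
      ([ id , (λ valid → ⊥-elim (unsolved (order-solution {n} τ↭ (subst (LOP n x) eq valid)))) ]′ (excess-nonneg-or-solved y x))
      where
      unsolved : ¬ (∃₂ λ a σ → o ≡ minimal a × τ ≡ a ∷ σ)
      unsolved (a , _ , refl , _) = 1≢0 (trans (sym (sum-⟦≡⟧ a)) (sum-0 isMinimal≡0))
        where
        1≢0 : 1ℤ ≢ 0ℤ
        1≢0 ()
    select : ∀ o → eval (g y) x ≡ o → sum (λ a → isMinimal a o) * excess y x ≤ excess y x
    select (minimal b) eq = ≤-reflexive (trans (cong (_* excess y x) (sum-⟦≡⟧ b)) (*-identityˡ (excess y x)))
    select o@(reflexive _) eq     = other o eq (λ _ → refl)
    select o@(incomp _ _) eq      = other o eq (λ _ → refl)
    select o@(transFail _ _ _) eq = other o eq (λ _ → refl)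

  -- When `a` is not the true minimum, the answer "minimal a" is wrong, so `y` cannot be avoided and
  -- has a preimage.
  minimalExcess-nonneg : ∀ y a {t σ} → t ≢ a → t ∷ σ ↭ allFin N → 0ℤ ≤ minimalExcess y a (orderInput (t ∷ σ))
  minimalExcess-nonneg y a {t} {σ} t≢a τ↭ = go (eval (g y) x) refl
    where
    x = orderInput (t ∷ σ)
    zero-case : 0ℤ ≤ 0ℤ * excess y x
    zero-case = ≤-reflexive (sym (*-zeroˡ (excess y x)))
    go : ∀ o → eval (g y) x ≡ o → 0ℤ ≤ isMinimal a o * excess y x
    go (reflexive _)     eq = zero-case
    go (incomp _ _)      eq = zero-case
    go (transFail _ _ _) eq = zero-case
    go (minimal b)       eq with a ≟ b
    ... | no _     = zero-case
    ... | yes refl = ≤-trans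
      ([ id , (λ valid → ⊥-elim (unsolved (order-solution {n} τ↭ (subst (LOP n x) eq valid)))) ]′ (excess-nonneg-or-solved y x))
      (≤-reflexive (sym (*-identityˡ (excess y x))))
      where
      unsolved : ¬ (∃₂ λ a′ σ′ → minimal a ≡ minimal a′ × t ∷ σ ≡ a′ ∷ σ′)
      unsolved (_ , _ , refl , refl) = t≢a refl

  -- One tree per index `i`. Summing over `i` outside the trees keeps the degree independent of 2^k.
  hitTree : Fin (2 ℕ.^ k ℕ.+ 1) → Fin N → Fin (2 ℕ.^ k) → DT (Fin N × Fin N) ℤ
  hitTree y a i = g y >>= λ o → sequence (λ j → f (i , j)) >>= λ b → leaf (isMinimal a o * ⟦ decode b ℕ.≟ toℕ y ⟧)

  minimalTree : Fin (2 ℕ.^ k ℕ.+ 1) → Fin N → DT (Fin N × Fin N) ℤ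
  minimalTree y a = g y >>= λ o → leaf (isMinimal a o)

  eval-hitTree : ∀ y a i x → eval (hitTree y a i) x ≡ isMinimal a (eval (g y) x) * ⟦ value x i ℕ.≟ toℕ y ⟧
  eval-hitTree y a i x = trans (eval->>= (g y) _ x) (trans
    (eval->>= (sequence (λ j → f (i , j))) (λ b → leaf (isMinimal a (eval (g y) x) * ⟦ decode b ℕ.≟ toℕ y ⟧)) x)
    (cong (λ v → isMinimal a (eval (g y) x) * ⟦ v ℕ.≟ toℕ y ⟧) (decode-cong (eval-sequence (λ j → f (i , j)) x))))

  minimalExcess-trees : ∀ y a x → minimalExcess y a x ≡
    sum (λ i → eval (hitTree y a i) x) + -1ℤ * eval (minimalTree y a) x
  minimalExcess-trees y a x = begin
    m * (preimages y x + -1ℤ)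
      ≡⟨ lem m (preimages y x) ⟩
    m * preimages y x + -1ℤ * m
      ≡⟨ cong₂ (λ s t → s + -1ℤ * t) (*-distribˡ-sum m (λ i → ⟦ value x i ℕ.≟ toℕ y ⟧)) (sym (eval->>= (g y) (λ o → leaf (isMinimal a o)) x)) ⟩
    sum (λ i → m * ⟦ value x i ℕ.≟ toℕ y ⟧) + -1ℤ * eval (minimalTree y a) x
      ≡⟨ cong (λ s → s + -1ℤ * eval (minimalTree y a) x) (sum-cong-≗ λ i → sym (eval-hitTree y a i x)) ⟩
    sum (λ i → eval (hitTree y a i) x) + -1ℤ * eval (minimalTree y a) x ∎
    where
    open ≡-Reasoning
    m = isMinimal a (eval (g y) x)
    lem : ∀ m q → m * (q + -1ℤ) ≡ m * q + -1ℤ * m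
    lem = solve-∀

  depth-hitTree : ∀ y a i → depth (hitTree y a i) ℕ.≤ D
  depth-hitTree y a i = depth->>= (g y) _ (g-depth y) λ o →
    subst (depth (sequence (λ j → f (i , j)) >>= λ b → leaf (isMinimal a o * ⟦ decode b ℕ.≟ toℕ y ⟧)) ℕ.≤_) (ℕₚ.+-identityʳ (suc k ℕ.* d))
      (depth->>= (sequence (λ j → f (i , j))) (λ b → leaf (isMinimal a o * ⟦ decode b ℕ.≟ toℕ y ⟧))
        (depth-sequence (λ j → f (i , j)) (λ j → f-depth (i , j))) (λ _ → z≤n))

  depth-minimalTree : ∀ y a → depth (minimalTree y a) ℕ.≤ D
  depth-minimalTree y a = depth->>= (g y) (λ o → leaf (isMinimal a o)) (g-depth y) (λ _ → z≤n)

  DegreeAtMost-minimalExcess : ∀ y a {W} → Unique W →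
    DegreeAtMost u (length W) (λ p → permSum W (λ τ → minimalExcess y a (orderInput (insertAt p a τ))))
  DegreeAtMost-minimalExcess y a {W} unique = DegreeAtMost-cong (λ {p} _ → sym (expand p))
    (DegreeAtMost-+ (DegreeAtMost-sum (λ i p → permSum W (λ τ → T (hitTree y a i) p τ)) λ i → tree (hitTree y a i) (depth-hitTree y a i))
                    (DegreeAtMost-* -1ℤ (tree (minimalTree y a) (depth-minimalTree y a))))
    where
    T : DT (Fin N × Fin N) ℤ → ℕ → List (Fin N) → ℤ
    T t p τ = eval t (orderInput (insertAt p a τ))
    tree : ∀ t → depth t ℕ.≤ D → DegreeAtMost u (length W) (λ p → permSum W (T t p))
    tree t t≤D = DegreeAtMost-cong (λ {p} _ → permSum-cong W λ {τ} _ → *-identityˡ (T t p τ)) (DegreeAtMost-tree {D = D} a unique t [] t≤D)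
    expand : ∀ p → permSum W (λ τ → minimalExcess y a (orderInput (insertAt p a τ))) ≡
      sum (λ i → permSum W (λ τ → T (hitTree y a i) p τ)) + -1ℤ * permSum W (T (minimalTree y a) p)
    expand p = trans (permSum-cong W λ {τ} _ → minimalExcess-trees y a (orderInput (insertAt p a τ)))
      (trans (permSum-+ W (λ τ → sum (λ i → T (hitTree y a i) p τ)) (λ τ → -1ℤ * T (minimalTree y a) p τ))
        (cong₂ _+_ (permSum-sum W (λ i τ → T (hitTree y a i) p τ)) (permSum-* W -1ℤ (T (minimalTree y a) p))))

  permSum-minimalExcess : (r ℕ.+ r) ℕ.* (r ℕ.* r) ℕ.< N → ∀ y a →
    0ℤ ≤ permSum (allFin N) (λ τ → minimalExcess y a (orderInput τ))
  permSum-minimalExcess 2r³<N y a with allFin-↭-∷ a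
  ... | W , a∷W↭ = subst (0ℤ ≤_)
      (trans (sym (permSum-positions a W G)) (permSum-↭ G a∷W↭))
      (∑-nonneg-of-tail (DegreeAtMost-minimalExcess y a (tail unique)) tail-nonneg
        -- Positions of `a` run from 0 to N - 1, the length of `W`; this turns the strict bound into
        -- the required one.
        (ℕₚ.≤-pred (subst ((r ℕ.+ r) ℕ.* (r ℕ.* r) ℕ.<_) (sym ∣a∷W∣≡N) 2r³<N)))
    where
    G : List (Fin N) → ℤ
    G τ = minimalExcess y a (orderInput τ)
    unique : Unique (a ∷ W)
    unique = Unique-↭ (↭-sym a∷W↭) (allFin⁺ N)
    ∣a∷W∣≡N : suc (length W) ≡ N
    ∣a∷W∣≡N = trans (↭-length a∷W↭) (length-tabulate id)
    -- At a positive position the head of the order is still that of `τ`, which differs from `a`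
    -- because `a ∷ W` has no repetitions.
    tail-nonneg : ∀ {p} → 0 ℕ.< p → p ℕ.≤ length W → 0ℤ ≤ permSum W (λ τ → G (insertAt p a τ))
    tail-nonneg {suc p} _ p<∣W∣ = permSum-nonneg W λ
      { {[]}    []↭W  → ⊥-elim (ℕₚ.n≮0 (subst (p ℕ.<_) (sym (↭-length []↭W)) p<∣W∣))
      ; {t ∷ τ} t∷τ↭W → minimalExcess-nonneg y a
          (λ { refl → Unique[x∷xs]⇒x∉xs unique (∈-resp-↭ t∷τ↭W (here refl)) })
          (↭-trans (insertAt-↭ (suc p) a (t ∷ τ)) (↭-trans (prep a t∷τ↭W) a∷W↭)) }

  permSum-excess : (r ℕ.+ r) ℕ.* (r ℕ.* r) ℕ.< N → ∀ y → 0ℤ ≤ permSum (allFin N) (λ τ → excess y (orderInput τ))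
  permSum-excess 2r³<N y = begin
    0ℤ
      ≤⟨ sum-nonneg {N} (permSum-minimalExcess 2r³<N y) ⟩
    sum (λ a → permSum (allFin N) (λ τ → minimalExcess y a (orderInput τ)))
      ≡⟨ sym (permSum-sum (allFin N) (λ a τ → minimalExcess y a (orderInput τ))) ⟩
    permSum (allFin N) (λ τ → sum (λ a → minimalExcess y a (orderInput τ)))
      ≤⟨ permSum-mono (allFin N) (sum-minimalExcess y) ⟩
    permSum (allFin N) (λ τ → excess y (orderInput τ)) ∎
    where open ≤-Reasoning

  -- If `N` were larger, the total excess over all orders and candidates would be nonnegative when
  -- summed by candidate, yet at most -1 when summed by order.
  formulation-lower-bound : (r ℕ.+ r) ℕ.* (r ℕ.* r) ℕ.≥ N
  formulation-lower-bound = ℕₚ.≮⇒≥ λ 2r³<N → 0≰-1 (begin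
    0ℤ
      ≤⟨ sum-nonneg {2 ℕ.^ k ℕ.+ 1} (permSum-excess 2r³<N) ⟩
    sum (λ y → permSum (allFin N) (λ τ → excess y (orderInput τ)))
      ≡⟨ sym (permSum-sum (allFin N) (λ y τ → excess y (orderInput τ))) ⟩
    permSum (allFin N) (λ τ → sum (λ y → excess y (orderInput τ)))
      ≤⟨ permSum-≤-1 (allFin N) (λ τ → sum-excess-≤-1 (orderInput τ)) ⟩
    -1ℤ ∎)
    where
    open ≤-Reasoning
    0≰-1 : ¬ (0ℤ ≤ -1ℤ)
    0≰-1 ()

-- Growth of the cost

n<2^n : ∀ n → n ℕ.< 2 ℕ.^ n
n<2^n zero    = s≤s z≤n
n<2^n (suc n) = ℕₚ.+-mono-≤ (ℕₚ.≤-trans (s≤s z≤n) (n<2^n n)) (ℕₚ.≤-trans (n<2^n n) (ℕₚ.m≤m+n (2 ℕ.^ n) 0))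

double-≤-2^ : ∀ {a e} → a ℕ.≤ 2 ℕ.^ e → a ℕ.+ a ℕ.≤ 2 ℕ.^ suc e
double-≤-2^ {e = e} a≤ = ℕₚ.+-mono-≤ a≤ (ℕₚ.≤-trans a≤ (ℕₚ.m≤m+n (2 ℕ.^ e) 0))

product-≤-2^ : ∀ {a b e f} → a ℕ.≤ 2 ℕ.^ e → b ℕ.≤ 2 ℕ.^ f → a ℕ.* b ℕ.≤ 2 ℕ.^ (e ℕ.+ f)
product-≤-2^ {e = e} {f} a≤ b≤ = ℕₚ.≤-trans (ℕₚ.*-mono-≤ a≤ b≤) (ℕₚ.≤-reflexive (sym (ℕₚ.^-distribˡ-+-* 2 e f)))

-- Tailored to the final comparison, with `A = 6 * c`. In the induction the left side at most
-- doubles; the shift 10 leaves room for the base case 14 ≤ 1024.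
quadratic≤2^ : ∀ A → A ℕ.* (A ℕ.+ 12) ℕ.+ 14 ℕ.≤ 2 ℕ.^ (A ℕ.+ 10)
quadratic≤2^ zero    = ℕₚ.m≤m+n 14 1010
quadratic≤2^ (suc A) = ℕₚ.≤-trans
  (ℕₚ.≤-trans (ℕₚ.m≤m+n (suc A ℕ.* (suc A ℕ.+ 12) ℕ.+ 14) (A ℕ.* A ℕ.+ 10 ℕ.* A ℕ.+ 1)) (ℕₚ.≤-reflexive (lem A)))
  (double-≤-2^ {e = A ℕ.+ 10} (quadratic≤2^ A))
  where
  lem : ∀ A → suc A ℕ.* (suc A ℕ.+ 12) ℕ.+ 14 ℕ.+ (A ℕ.* A ℕ.+ 10 ℕ.* A ℕ.+ 1)
            ≡ A ℕ.* (A ℕ.+ 12) ℕ.+ 14 ℕ.+ (A ℕ.* (A ℕ.+ 12) ℕ.+ 14)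
  lem = ℕ-solve-∀

k≤log-sAvoidSize : ∀ k → k ℕ.≤ ⌈log₂ sAvoidSize k ⌉
k≤log-sAvoidSize k = subst (ℕ._≤ ⌈log₂ sAvoidSize k ⌉) (⌈log₂2^n⌉≡n k) (⌈log₂⌉-mono-≤ (ℕₚ.m≤m*n (2 ℕ.^ k) (suc k)))

log-LOPSize : ∀ n → ⌈log₂ LOPSize n ⌉ ≡ n ℕ.+ n
log-LOPSize n = trans (cong ⌈log₂_⌉ (sym (ℕₚ.^-distribˡ-+-* 2 n n))) (⌈log₂2^n⌉≡n (n ℕ.+ n))

-- Both `k` and `d` are at most `B`, so D + 1 ≤ (B + 1)² ≤ 2^(2E), then r ≤ 2^(2 + 2E) and 2r³ ≤
-- 2^(7 + 6E); this must reach N = 2^n.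
cost-lower-bound : ∀ {n B} E → LOPReducesWithin n B → B ℕ.< 2 ℕ.^ E → n ℕ.≤ 7 ℕ.+ 6 ℕ.* E
cost-lower-bound {n} {B} E (k , d , Φ , cost≤B) B<2^E = ℕₚ.≮⇒≥ λ 7+6E<n → ℕₚ.<-irrefl refl
  (ℕₚ.<-≤-trans (ℕₚ.^-monoʳ-< 2 (s≤s (s≤s z≤n)) 7+6E<n) (ℕₚ.≤-trans (formulation-lower-bound Φ) 2r³≤))
  where
  D = d ℕ.+ suc k ℕ.* d
  r = suc (D ℕ.+ D) ℕ.+ suc (D ℕ.+ D)
  k≤B : k ℕ.≤ B
  k≤B = ℕₚ.≤-trans (k≤log-sAvoidSize k) (ℕₚ.≤-trans (ℕₚ.m≤m+n _ d) cost≤B)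
  d≤B : d ℕ.≤ B
  d≤B = ℕₚ.≤-trans (ℕₚ.m≤n+m d _) cost≤B
  square : ∀ B → suc (B ℕ.+ suc B ℕ.* B) ≡ suc B ℕ.* suc B
  square = ℕ-solve-∀
  D<2^2E : D ℕ.< 2 ℕ.^ (E ℕ.+ E)
  D<2^2E = ℕₚ.≤-trans (s≤s (ℕₚ.+-mono-≤ d≤B (ℕₚ.*-mono-≤ (s≤s k≤B) d≤B)))
    (ℕₚ.≤-trans (ℕₚ.≤-reflexive (square B)) (product-≤-2^ {e = E} {E} B<2^E B<2^E))
  r≤ : r ℕ.≤ 2 ℕ.^ (2 ℕ.+ (E ℕ.+ E))
  r≤ = double-≤-2^ {e = 1 ℕ.+ (E ℕ.+ E)} (ℕₚ.≤-trans (s≤s (ℕₚ.+-monoʳ-≤ D (ℕₚ.n≤1+n D))) (double-≤-2^ {e = E ℕ.+ E} D<2^2E))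
  exponent : ∀ E → 3 ℕ.+ (E ℕ.+ E) ℕ.+ ((2 ℕ.+ (E ℕ.+ E)) ℕ.+ (2 ℕ.+ (E ℕ.+ E))) ≡ 7 ℕ.+ 6 ℕ.* E
  exponent = ℕ-solve-∀
  2r³≤ : (r ℕ.+ r) ℕ.* (r ℕ.* r) ℕ.≤ 2 ℕ.^ (7 ℕ.+ 6 ℕ.* E)
  2r³≤ = subst (λ e → (r ℕ.+ r) ℕ.* (r ℕ.* r) ℕ.≤ 2 ℕ.^ e) (exponent E)
    (product-≤-2^ {e = 3 ℕ.+ (E ℕ.+ E)} {(2 ℕ.+ (E ℕ.+ E)) ℕ.+ (2 ℕ.+ (E ℕ.+ E))} (double-≤-2^ {e = 2 ℕ.+ (E ℕ.+ E)} r≤)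
      (product-≤-2^ {e = 2 ℕ.+ (E ℕ.+ E)} {2 ℕ.+ (E ℕ.+ E)} r≤ r≤))

-- The instances with parameter 2^m have input length of logarithm exactly 2^(m + 1), so its powers
-- are again powers of two.
polylog<2^ : ∀ c m → polylog c (LOPSize (2 ℕ.^ m)) ℕ.< 2 ℕ.^ suc (c ℕ.+ suc m ℕ.* c)
polylog<2^ c m = begin
  suc (c ℕ.* ⌈log₂ LOPSize (2 ℕ.^ m) ⌉ ℕ.^ c ℕ.+ c)
    ≡⟨ cong (λ L → suc (c ℕ.* L ℕ.^ c ℕ.+ c)) (trans (log-LOPSize (2 ℕ.^ m)) (cong (2 ℕ.^ m ℕ.+_) (sym (ℕₚ.+-identityʳ (2 ℕ.^ m))))) ⟩
  suc (c ℕ.* (2 ℕ.^ suc m) ℕ.^ c ℕ.+ c)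
    ≡⟨ cong (λ X → suc (c ℕ.* X ℕ.+ c)) (ℕₚ.^-*-assoc 2 (suc m) c) ⟩
  suc (c ℕ.* X ℕ.+ c)
    ≡⟨ sym (ℕₚ.+-suc (c ℕ.* X) c) ⟩
  c ℕ.* X ℕ.+ suc c
    ≤⟨ ℕₚ.+-mono-≤ (ℕₚ.*-monoˡ-≤ X (ℕₚ.<⇒≤ (n<2^n c)))
        (ℕₚ.≤-trans (n<2^n c) (ℕₚ.m≤m*n (2 ℕ.^ c) X {{ℕₚ.m^n≢0 2 (suc m ℕ.* c)}})) ⟩
  2 ℕ.^ c ℕ.* X ℕ.+ 2 ℕ.^ c ℕ.* X
    ≤⟨ double-≤-2^ {e = c ℕ.+ suc m ℕ.* c} (ℕₚ.≤-reflexive (sym (ℕₚ.^-distribˡ-+-* 2 c (suc m ℕ.* c)))) ⟩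
  2 ℕ.^ suc (c ℕ.+ suc m ℕ.* c) ∎
  where
  open ℕₚ.≤-Reasoning
  X = 2 ℕ.^ (suc m ℕ.* c)

theorem1p1 : ¬ LOP≤dt-sAvoid
theorem1p1 (c , reduces) = ℕₚ.<-irrefl refl (ℕₚ.≤-trans (ℕₚ.≤-trans (ℕₚ.≤-reflexive (lem c)) (quadratic≤2^ (6 ℕ.* c)))
  (cost-lower-bound (suc (c ℕ.+ suc m ℕ.* c)) (reduces (2 ℕ.^ m)) (polylog<2^ c m)))
  where
  -- With this `m`, the quantity 8 + 6E becomes A (A + 12) + 14 for A = 6c, which is at most 2^m =
  -- n, contradicting n ≤ 7 + 6E.
  m = 6 ℕ.* c ℕ.+ 10
  lem : ∀ c → suc (7 ℕ.+ 6 ℕ.* suc (c ℕ.+ suc (6 ℕ.* c ℕ.+ 10) ℕ.* c)) ≡ 6 ℕ.* c ℕ.* (6 ℕ.* c ℕ.+ 12) ℕ.+ 14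
  lem = ℕ-solve-∀
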